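{- For any $n\ge 3$, let $\mathrm{tw}(C_n)$ be the graph obtained from the cycle $C_n$ by adding a new vertex $v'$ adjacent to a vertex $v$ of $C_n$ and to both neighbors of $v$ in $C_n$. Then \[ X_{\mathrm{tw}(C_n)}=\sum_{I\vDash n,\ i_1\ge 4}2(i_1-3)w_{1I}e_{1I}+\sum_{I\in\mathcal W_{n+1},\ i_1,i_{ -1}\ge 3}2(2i_1-5)w_Ie_I+\sum_{I\in\mathcal W_{n-1},\ i_1\ge 3}4\Bigl(i_1-3+\frac{1}{i_1}\Bigr)w_Ie_{I2}. \]
   Context: $X_G=\sum_\kappa\prod_{v\in V(G)}x_{\kappa(v)}$ summed over proper colorings $\kappa:V(G)\to\{1,2,\dots\}$. A composition $I=i_1\cdots i_l\vDash n$ is a sequence of positive integers with sum $n$; $i_{ -1}=i_l$; $1I$ denotes the composition $1i_1\cdots i_l$ and $I2$ the composition $i_1\cdots i_l2$. $e_I=e_{i_1}\cdots e_{i_l}$ with $e_k$ elementary symmetric functions. $w_I=i_1(i_2-1)\cdots(i_l-1)$. $\mathcal W_n$ is the set of compositions of $n$ all of whose parts are at least $2$. -}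

module Defs where

open import Data.Bool using (Bool; true; false; _∧_; _∨_; not; if_then_else_)
open import Data.Nat using (ℕ; zero; suc; _+_; _*_; _∸_; _≡ᵇ_; _≤ᵇ_; _<ᵇ_)
open import Data.Fin using (Fin; toℕ)
import Data.Fin as Fin
open import Data.List using (List; []; _∷_; [_]; map; concatMap; length; filterᵇ; foldr; upTo; allFin; _++_)
open import Data.Nat.ListAction using (sum; product)
open import Data.Bool.ListAction using (and)
open import Data.Vec.Functional using () renaming (_∷_ to _∷ᶠ_)
open import Data.Integer using (+_)
open import Data.Rational using (ℚ; _/_; 0ℚ)
  renaming (_+_ to _+ℚ_; _*_ to _*ℚ_; _-_ to _-ℚ_)
open import Relation.Nullary using (does)

countᵇ : {A : Set} → (A → Bool) → List A → ℕ
countᵇ p xs = length (filterᵇ p xs)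

allᵇ : {A : Set} → (A → Bool) → List A → Bool
allᵇ p xs = and (map p xs)

allFuns : {B : Set} → List B → (m : ℕ) → List (Fin m → B)
allFuns bs zero = [ (λ ()) ]
allFuns bs (suc m) = concatMap (λ b → map (λ f → b ∷ᶠ f) (allFuns bs m)) bs

_==_ : {N : ℕ} → Fin N → Fin N → Bool
a == b = does (a Fin.≟ b)

-- Formal power series in x_1, x_2, ... are compared coefficientwise.
-- A monomial x^α only involves finitely many variables, so it is given
-- by some N and an exponent vector α : Fin N → ℕ (variables x_0..x_{N-1}).

proper : {m N : ℕ} → (Fin m → Fin m → Bool) → (Fin m → Fin N) → Bool
proper {m} adj κ =
  allᵇ (λ u → allᵇ (λ v → not (adj u v ∧ (κ u == κ v))) (allFin m)) (allFin m)

-- κ contributes the monomial ∏_v x_{κ(v)}; this equals x^α iff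
-- every colour c is used exactly α c times.
hasContent : {m N : ℕ} → (Fin m → Fin N) → (Fin N → ℕ) → Bool
hasContent {m} {N} κ α =
  allᵇ (λ c → countᵇ (λ v → κ v == c) (allFin m) ≡ᵇ α c) (allFin N)

-- coefficient of x^α in the chromatic symmetric function X_G
-- (colourings using a colour ≥ N cannot produce x^α)
XCoeff : (m : ℕ) → (Fin m → Fin m → Bool) → (N : ℕ) → (Fin N → ℕ) → ℕ
XCoeff m adj N α =
  countᵇ (λ κ → proper adj κ ∧ hasContent κ α) (allFuns (allFin N) m)

-- Elementary symmetric functions.
-- e_k = Σ_{S ⊆ ℕ, |S| = k} ∏_{c ∈ S} x_c, hence the coefficient of x^α
-- (α supported in Fin N) in e_{i_1} ⋯ e_{i_l} is the number of tuples
-- (S_1,…,S_l) of subsets of Fin N with |S_j| = i_j such that every c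
-- lies in exactly α c of the S_j.

Subset : ℕ → Set
Subset N = Fin N → Bool

size : {N : ℕ} → Subset N → ℕ
size {N} S = countᵇ S (allFin N)

allSubsets : (N : ℕ) → List (Subset N)
allSubsets N = allFuns (true ∷ false ∷ []) N

subsetTuples : (N : ℕ) → List ℕ → List (List (Subset N))
subsetTuples N [] = [ [] ]
subsetTuples N (k ∷ I) =
  concatMap (λ S → map (S ∷_) (subsetTuples N I))
            (filterᵇ (λ S → size S ≡ᵇ k) (allSubsets N))

eCoeff : (N : ℕ) → List ℕ → (Fin N → ℕ) → ℕ
eCoeff N I α =
  countᵇ (λ Ss → allᵇ (λ c → countᵇ (λ S → S c) Ss ≡ᵇ α c) (allFin N))
         (subsetTuples N I)

isCompositionᵇ : ℕ → List ℕ → Bool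
isCompositionᵇ n I = (sum I ≡ᵇ n) ∧ allᵇ (λ i → 1 ≤ᵇ i) I

listsOfLen : ℕ → ℕ → List (List ℕ)
listsOfLen zero n = [ [] ]
listsOfLen (suc l) n = concatMap (λ a → map (a ∷_) (listsOfLen l n)) (upTo (suc n))

-- every composition of n has length ≤ n and parts ≤ n
compositions : ℕ → List (List ℕ)
compositions n =
  filterᵇ (isCompositionᵇ n) (concatMap (λ l → listsOfLen l n) (upTo (suc n)))

allPartsGe2 : List ℕ → Bool
allPartsGe2 I = allᵇ (λ i → 2 ≤ᵇ i) I

firstGe : ℕ → List ℕ → Bool
firstGe k [] = false
firstGe k (i ∷ _) = k ≤ᵇ i

lastGe : ℕ → List ℕ → Bool
lastGe k [] = false
lastGe k (i ∷ []) = k ≤ᵇ i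
lastGe k (_ ∷ j ∷ I) = lastGe k (j ∷ I)

-- i_1 (only used for nonempty compositions)
first : List ℕ → ℕ
first [] = 0
first (i ∷ _) = i

w : List ℕ → ℕ
w [] = 1
w (i ∷ I) = i * product (map (λ j → j ∸ 1) I)

ℕtoℚ : ℕ → ℚ
ℕtoℚ n = + n / 1

-- 1/i (only used with i ≥ 3)
recip : ℕ → ℚ
recip zero = 0ℚ
recip (suc k) = + 1 / suc k

sumℚ : List ℚ → ℚ
sumℚ = foldr _+ℚ_ 0ℚ

-- tw(C_n): vertices 0,…,n-1 form the cycle C_n (i ~ i+1, and n-1 ~ 0),
-- v = 0, and the new vertex v' = n is adjacent to 0, 1 and n-1.

cycAdjℕ : ℕ → ℕ → ℕ → Bool
cycAdjℕ n a b =
  ((b ≡ᵇ suc a) ∧ (b <ᵇ n)) ∨ ((a ≡ᵇ suc b) ∧ (a <ᵇ n))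
  ∨ ((a ≡ᵇ 0) ∧ (b ≡ᵇ n ∸ 1)) ∨ ((b ≡ᵇ 0) ∧ (a ≡ᵇ n ∸ 1))

newAdjℕ : ℕ → ℕ → ℕ → Bool
newAdjℕ n a b =
  ((a ≡ᵇ n) ∧ ((b ≡ᵇ 0) ∨ (b ≡ᵇ 1) ∨ (b ≡ᵇ n ∸ 1)))
  ∨ ((b ≡ᵇ n) ∧ ((a ≡ᵇ 0) ∨ (a ≡ᵇ 1) ∨ (a ≡ᵇ n ∸ 1)))

twAdj : (n : ℕ) → Fin (suc n) → Fin (suc n) → Bool
twAdj n u v = cycAdjℕ n (toℕ u) (toℕ v) ∨ newAdjℕ n (toℕ u) (toℕ v)

rhsCoeff : (n N : ℕ) → (Fin N → ℕ) → ℚ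
rhsCoeff n N α =
    sumℚ (map (λ I → ℕtoℚ 2 *ℚ (ℕtoℚ (first I) -ℚ ℕtoℚ 3)
                     *ℚ ℕtoℚ (w (1 ∷ I)) *ℚ ℕtoℚ (eCoeff N (1 ∷ I) α))
              (filterᵇ (firstGe 4) (compositions n)))
  +ℚ sumℚ (map (λ I → ℕtoℚ 2 *ℚ (ℕtoℚ 2 *ℚ ℕtoℚ (first I) -ℚ ℕtoℚ 5)
                     *ℚ ℕtoℚ (w I) *ℚ ℕtoℚ (eCoeff N I α))
              (filterᵇ (λ I → allPartsGe2 I ∧ firstGe 3 I ∧ lastGe 3 I)
                       (compositions (suc n))))
  +ℚ sumℚ (map (λ I → ℕtoℚ 4 *ℚ ((ℕtoℚ (first I) -ℚ ℕtoℚ 3) +ℚ recip (first I))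
                     *ℚ ℕtoℚ (w I) *ℚ ℕtoℚ (eCoeff N (I ++ [ 2 ]) α))
              (filterᵇ (λ I → allPartsGe2 I ∧ firstGe 3 I)
                       (compositions (n ∸ 1))))

{-# OPTIONS --safe #-}
module Submission where

-- Let T_m = Σ_{I ⊨ m} (i_1 − 1)(i_2 − 1)⋯ e_I, so that T_n = Σ_k (k − 1) e_k T_{n−k} for n ≥ 1.
-- Colourings of a path on n vertices with first colour c are counted by Σ_{S ∋ c} x^S T_{n−|S|}, and those
-- with end colours c ≠ d by Σ_{S ∋ c, d} x^S T_{n−|S|}: both follow by induction on n from the transfer
-- recursion, because Σ_k k e_k T_{n−k} = Σ_k e_k T_{n−k}.  Hence X_{P_n} = Σ_k k e_k T_{n−k} and
-- X_{C_n} = Σ_k k(k − 1) e_k T_{n−k}.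
-- Inclusion–exclusion over the colours of v and v' gives
--   X_{tw(C_n)} = 2 e_1 X_{C_n} + 4 X_{C_{n+1}} + 2 e_2 X_{P_{n−1}} − 6 X_{P_{n+1}},
-- and the recursion for T_n absorbs the terms with i_1 ≤ 2 and the compositions ending in 2.

open import Defs
open import Data.Bool using (Bool; true; false; _∧_; _∨_; not; T)
open import Data.Bool.ListAction using (and)
open import Data.Bool.Properties using (∧-zeroʳ; T-∧; T-∨)
open import Data.Empty using (⊥-elim)
open import Data.Fin as Fin using (Fin; zero; suc; toℕ)
import Data.Fin.Properties as Finₚ
open import Data.Integer using (ℤ; +_; _+_; _*_; _-_; -_; 0ℤ; 1ℤ)
import Data.Integer.Properties as ℤₚ
open import Data.Integer.Tactic.RingSolver using (solve-∀)
open import Data.List using (List; []; _∷_; [_]; _++_; map; concatMap; filterᵇ; foldr; null; upTo; allFin)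
open import Data.List.Properties using (map-tabulate; map-applyUpTo; map-cong; concatMap-cong; foldr-++)
open import Data.List.Relation.Unary.All using (All; []; _∷_)
open import Data.List.Relation.Unary.All.Properties using (tabulate⁺; tabulate⁻)
open import Data.Nat as ℕ using (ℕ; zero; suc; _≡ᵇ_; _≤ᵇ_; _<ᵇ_; _∸_; _≤_; s≤s)
open import Data.Nat.ListAction using (sum; product)
import Data.Nat.Properties as ℕₚ
open import Data.Product using (_×_; _,_; proj₁; proj₂)
open import Data.Rational using (ℚ; fromℚᵘ) renaming (_+_ to _+ℚ_; _*_ to _*ℚ_; _-_ to _-ℚ_; -_ to -ℚ_)
import Data.Rational.Properties as ℚₚ
open import Data.Rational.Unnormalised as ℚᵘ using (mkℚᵘ; *≡*)
import Data.Rational.Unnormalised.Properties as ℚᵘₚ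
open import Data.Sum as Sum using (_⊎_; inj₁; inj₂)
open import Data.Unit using (tt)
open import Data.Vec as Vec using (Vec; []; _∷_; lookup; replicate; _[_]≔_)
open import Data.Vec.Functional using () renaming (_∷_ to _∷ᶠ_)
open import Data.Vec.Properties using (lookup-replicate; lookup∘tabulate)
open import Function using (_∘_; id; Equivalence)
open import Relation.Binary.PropositionalEquality hiding ([_])
open import Relation.Nullary using (yes; no)
open Equivalence using (to; from)
open ≡-Reasoning

-- Colourings with a prescribed end colour are not symmetric series, so they have no expansion in
-- the e_I. Sums over colour sets S treat them on the same footing as the symmetric ones, and a
-- condition such as c ∈ S is then removed by deleting c from S. All identities are proved for an
-- arbitrary test function `φ`; only at the end is it the indicator of the exponent α. This
-- generality makes a fixed factor movable into the test function: an expansion along compositions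
-- I2 is an expansion along I tested against `e 2 φ`. The coefficients of the theorem come from
-- sorting the four series by the size k of the first part. The quadratic polynomials in k that
-- appear are the stated ones for large k, and the ranges of i_1 cut them off at small k. The
-- resulting errors are multiples of e_1 T_n, e_2 T_{n-1} and e_1 e_2 T_{n-2}, and they cancel in
-- the sum. The fraction 1/i_1 cancels against the factor i_1 of w_I, so the argument runs over the
-- integers and passes to the rationals only in its last part.

private variable
  A B : Set
  N : ℕ

-- Finite sums of integers

𝟙 : Bool → ℤ
𝟙 true = 1ℤ
𝟙 false = 0ℤ

𝟙-∧ : ∀ a b → 𝟙 (a ∧ b) ≡ 𝟙 a * 𝟙 b
𝟙-∧ true b = sym (ℤₚ.*-identityˡ (𝟙 b))
𝟙-∧ false b = refl

𝟙-not : ∀ b → 𝟙 (not b) ≡ 1ℤ - 𝟙 b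
𝟙-not true = refl
𝟙-not false = refl

-- Opaque, so that unification treats ∑ as injective.
opaque
  ∑ : List A → (A → ℤ) → ℤ
  ∑ [] f = 0ℤ
  ∑ (x ∷ xs) f = f x + ∑ xs f

  ∑-[] : (f : A → ℤ) → ∑ [] f ≡ 0ℤ
  ∑-[] f = refl

  ∑-∷ : (x : A) (xs : List A) (f : A → ℤ) → ∑ (x ∷ xs) f ≡ f x + ∑ xs f
  ∑-∷ x xs f = refl

interchange : ∀ a b c d → (a + b) + (c + d) ≡ (a + c) + (b + d)
interchange = solve-∀

opaque
  unfolding ∑

  ∑-cong : (xs : List A) {f g : A → ℤ} → (∀ x → f x ≡ g x) → ∑ xs f ≡ ∑ xs g
  ∑-cong [] h = refl
  ∑-cong (x ∷ xs) h = cong₂ _+_ (h x) (∑-cong xs h)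

  ∑-zero : (xs : List A) → ∑ xs (λ _ → 0ℤ) ≡ 0ℤ
  ∑-zero [] = refl
  ∑-zero (x ∷ xs) = trans (ℤₚ.+-identityˡ _) (∑-zero xs)

  ∑-+ : (xs : List A) (f g : A → ℤ) → ∑ xs (λ x → f x + g x) ≡ ∑ xs f + ∑ xs g
  ∑-+ [] f g = refl
  ∑-+ (x ∷ xs) f g =
    trans (cong (λ z → f x + g x + z) (∑-+ xs f g)) (interchange (f x) (g x) _ _)

  ∑-*ˡ : (xs : List A) (k : ℤ) (f : A → ℤ) → ∑ xs (λ x → k * f x) ≡ k * ∑ xs f
  ∑-*ˡ [] k f = sym (ℤₚ.*-zeroʳ k)
  ∑-*ˡ (x ∷ xs) k f =
    trans (cong (λ z → k * f x + z) (∑-*ˡ xs k f)) (sym (ℤₚ.*-distribˡ-+ k (f x) _))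

  ∑-*ʳ : (xs : List A) (k : ℤ) (f : A → ℤ) → ∑ xs (λ x → f x * k) ≡ ∑ xs f * k
  ∑-*ʳ xs k f = trans (∑-cong xs (λ x → ℤₚ.*-comm (f x) k))
    (trans (∑-*ˡ xs k f) (ℤₚ.*-comm k _))

  ∑-− : (xs : List A) (f g : A → ℤ) → ∑ xs (λ x → f x - g x) ≡ ∑ xs f - ∑ xs g
  ∑-− xs f g = trans (∑-+ xs f (λ x → - g x)) (cong (λ z → ∑ xs f + z) neg)
    where
    neg : ∑ xs (λ x → - g x) ≡ - ∑ xs g
    neg = trans (∑-cong xs (λ x → sym (ℤₚ.-1*i≡-i (g x))))
      (trans (∑-*ˡ xs (- 1ℤ) g) (ℤₚ.-1*i≡-i _))

  ∑-swap : (xs : List A) (ys : List B) (f : A → B → ℤ) →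
    ∑ xs (λ x → ∑ ys (f x)) ≡ ∑ ys (λ y → ∑ xs (λ x → f x y))
  ∑-swap [] ys f = sym (∑-zero ys)
  ∑-swap (x ∷ xs) ys f =
    trans (cong (λ z → ∑ ys (f x) + z) (∑-swap xs ys f)) (sym (∑-+ ys (f x) _))

  ∑-++ : (xs ys : List A) (f : A → ℤ) → ∑ (xs ++ ys) f ≡ ∑ xs f + ∑ ys f
  ∑-++ [] ys f = sym (ℤₚ.+-identityˡ _)
  ∑-++ (x ∷ xs) ys f = trans (cong (λ z → f x + z) (∑-++ xs ys f)) (sym (ℤₚ.+-assoc (f x) _ _))

  ∑-map : (h : A → B) (xs : List A) (f : B → ℤ) → ∑ (map h xs) f ≡ ∑ xs (f ∘ h)
  ∑-map h [] f = refl
  ∑-map h (x ∷ xs) f = cong (λ z → f (h x) + z) (∑-map h xs f)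

  ∑-concatMap : (h : A → List B) (xs : List A) (f : B → ℤ) →
    ∑ (concatMap h xs) f ≡ ∑ xs (λ x → ∑ (h x) f)
  ∑-concatMap h [] f = refl
  ∑-concatMap h (x ∷ xs) f =
    trans (∑-++ (h x) (concatMap h xs) f) (cong (λ z → ∑ (h x) f + z) (∑-concatMap h xs f))

  ∑-filter : (p : A → Bool) (xs : List A) (f : A → ℤ) →
    ∑ (filterᵇ p xs) f ≡ ∑ xs (λ x → 𝟙 (p x) * f x)
  ∑-filter p [] f = refl
  ∑-filter p (x ∷ xs) f with p x
  ... | true = cong₂ _+_ (sym (ℤₚ.*-identityˡ (f x))) (∑-filter p xs f)
  ... | false = trans (∑-filter p xs f) (sym (ℤₚ.+-identityˡ _))

  ∑-countᵇ : (p : A → Bool) (xs : List A) → + countᵇ p xs ≡ ∑ xs (λ x → 𝟙 (p x))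
  ∑-countᵇ p [] = refl
  ∑-countᵇ p (x ∷ xs) with p x
  ... | true = cong (λ z → 1ℤ + z) (∑-countᵇ p xs)
  ... | false = trans (∑-countᵇ p xs) (sym (ℤₚ.+-identityˡ _))

∑-singleton : (x : A) (f : A → ℤ) → ∑ (x ∷ []) f ≡ f x
∑-singleton x f = trans (∑-∷ x [] f) (trans (cong (λ z → f x + z) (∑-[] f)) (ℤₚ.+-identityʳ (f x)))

*-left-comm : ∀ a b c → a * (b * c) ≡ b * (a * c)
*-left-comm = solve-∀

∑-swap-* : (xs : List A) (ys : List B) (c : A → ℤ) (d : B → ℤ) (f : A → B → ℤ) →
  ∑ xs (λ x → c x * ∑ ys (λ y → d y * f x y)) ≡ ∑ ys (λ y → d y * ∑ xs (λ x → c x * f x y))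
∑-swap-* xs ys c d f = begin
  ∑ xs (λ x → c x * ∑ ys (λ y → d y * f x y))
    ≡⟨ ∑-cong xs (λ x → sym (∑-*ˡ ys (c x) _)) ⟩
  ∑ xs (λ x → ∑ ys (λ y → c x * (d y * f x y)))
    ≡⟨ ∑-swap xs ys _ ⟩
  ∑ ys (λ y → ∑ xs (λ x → c x * (d y * f x y)))
    ≡⟨ ∑-cong ys (λ y → trans (∑-cong xs (λ x → *-left-comm (c x) (d y) (f x y))) (∑-*ˡ xs (d y) _)) ⟩
  ∑ ys (λ y → d y * ∑ xs (λ x → c x * f x y)) ∎

∑-allFuns : (bs : List B) (m : ℕ) (f : (Fin (suc m) → B) → ℤ) →
  ∑ (allFuns bs (suc m)) f ≡ ∑ bs (λ b → ∑ (allFuns bs m) (λ g → f (b ∷ᶠ g)))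
∑-allFuns bs m f =
  trans (∑-concatMap _ bs f) (∑-cong bs (λ b → ∑-map (b ∷ᶠ_) (allFuns bs m) f))

allFin-suc : ∀ N → allFin (suc N) ≡ zero ∷ map suc (allFin N)
allFin-suc N = cong (zero ∷_) (sym (map-tabulate id suc))

∑-allFin : ∀ N (f : Fin (suc N) → ℤ) → ∑ (allFin (suc N)) f ≡ f zero + ∑ (allFin N) (f ∘ suc)
∑-allFin N f = trans (cong (λ xs → ∑ xs f) (allFin-suc N)) (trans (∑-∷ zero _ f) (cong (λ z → f zero + z) (∑-map suc (allFin N) f)))

-- Kronecker deltas on colours

eq neq : ∀ {N} → Fin N → Fin N → ℤ
eq a b = 𝟙 (a == b)
neq a b = 1ℤ - eq a b

==-sym : ∀ {N} (a b : Fin N) → (a == b) ≡ (b == a)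
==-sym a b with a Fin.≟ b | b Fin.≟ a
... | yes _ | yes _ = refl
... | yes p | no q = ⊥-elim (q (sym p))
... | no p | yes q = ⊥-elim (p (sym q))
... | no _ | no _ = refl

neq-sym : ∀ {N} (a b : Fin N) → neq a b ≡ neq b a
neq-sym a b = cong (λ t → 1ℤ - 𝟙 t) (==-sym a b)

==-suc : ∀ {N} (a b : Fin N) → (Fin.suc a == suc b) ≡ (a == b)
==-suc a b with a Fin.≟ b
... | yes _ = refl
... | no _ = refl

∑-eq : ∀ {N} (a : Fin N) (f : Fin N → ℤ) → ∑ (allFin N) (λ b → eq a b * f b) ≡ f a
∑-eq {suc N} zero f = begin
  ∑ (allFin (suc N)) (λ b → eq zero b * f b) ≡⟨ ∑-allFin N _ ⟩
  1ℤ * f zero + ∑ (allFin N) (λ b → 0ℤ * f (suc b)) ≡⟨ cong₂ _+_ (ℤₚ.*-identityˡ (f zero)) (∑-zero (allFin N)) ⟩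
  f zero + 0ℤ ≡⟨ ℤₚ.+-identityʳ _ ⟩
  f zero ∎
∑-eq {suc N} (suc a) f = begin
  ∑ (allFin (suc N)) (λ b → eq (suc a) b * f b) ≡⟨ ∑-allFin N _ ⟩
  0ℤ + ∑ (allFin N) (λ b → eq (suc a) (suc b) * f (suc b)) ≡⟨ ℤₚ.+-identityˡ _ ⟩
  ∑ (allFin N) (λ b → eq (suc a) (suc b) * f (suc b))
    ≡⟨ ∑-cong (allFin N) (λ b → cong (λ t → 𝟙 t * f (suc b)) (==-suc a b)) ⟩
  ∑ (allFin N) (λ b → eq a b * f (suc b)) ≡⟨ ∑-eq a (f ∘ suc) ⟩
  f (suc a) ∎

∑-neq : ∀ {N} (a : Fin N) (f : Fin N → ℤ) →
  ∑ (allFin N) (λ b → neq a b * f b) ≡ ∑ (allFin N) f - f a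
∑-neq {N} a f = begin
  ∑ (allFin N) (λ b → neq a b * f b) ≡⟨ ∑-cong (allFin N) (λ b → lem (eq a b) (f b)) ⟩
  ∑ (allFin N) (λ b → f b - eq a b * f b) ≡⟨ ∑-− (allFin N) f _ ⟩
  ∑ (allFin N) f - ∑ (allFin N) (λ b → eq a b * f b) ≡⟨ cong (λ z → ∑ (allFin N) f - z) (∑-eq a f) ⟩
  ∑ (allFin N) f - f a ∎
  where
  lem : ∀ x y → (1ℤ - x) * y ≡ y - x * y
  lem = solve-∀

-- The factor vanishes at a = b, so identities valid only for distinct colours can be applied under
-- a sum.
neq-guard : ∀ {N} (a b : Fin N) {x y : ℤ} → (a ≢ b → x ≡ y) → neq a b * x ≡ neq a b * y
neq-guard a b h with a Fin.≟ b
... | yes _ = refl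
... | no p = cong (1ℤ *_) (h p)

-- Colour sets and exponent vectors

-- Sets and exponents are vectors rather than functions, so that facts such as `⊕-comm` are genuine
-- equalities and can be substituted inside a test function.
subsets : ∀ N → List (Vec Bool N)
subsets zero = [] ∷ []
subsets (suc N) = concatMap (λ b → map (b ∷_) (subsets N)) (true ∷ false ∷ [])

∑-subsets : ∀ N (g : Vec Bool (suc N) → ℤ) →
  ∑ (subsets (suc N)) g ≡ ∑ (subsets N) (g ∘ (true ∷_)) + ∑ (subsets N) (g ∘ (false ∷_))
∑-subsets N g = begin
  ∑ (subsets (suc N)) g ≡⟨ ∑-concatMap _ (true ∷ false ∷ []) g ⟩
  ∑ (true ∷ false ∷ []) (λ b → ∑ (map (b ∷_) (subsets N)) g) ≡⟨ ∑-∷ true (false ∷ []) _ ⟩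
  ∑ (map (true ∷_) (subsets N)) g + ∑ (false ∷ []) (λ b → ∑ (map (b ∷_) (subsets N)) g)
    ≡⟨ cong₂ _+_ (∑-map _ (subsets N) g) (∑-∷ false [] (λ b → ∑ (map (b ∷_) (subsets N)) g)) ⟩
  ∑ (subsets N) (g ∘ (true ∷_)) + (∑ (map (false ∷_) (subsets N)) g + ∑ [] _)
    ≡⟨ cong (λ z → ∑ (subsets N) (g ∘ (true ∷_)) + z)
         (trans (cong₂ _+_ (∑-map _ (subsets N) g) (∑-[] (λ b → ∑ (map (b ∷_) (subsets N)) g))) (ℤₚ.+-identityʳ _)) ⟩
  ∑ (subsets N) (g ∘ (true ∷_)) + ∑ (subsets N) (g ∘ (false ∷_)) ∎

card : ∀ {N} → Vec Bool N → ℕ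
card [] = 0
card (true ∷ S) = suc (card S)
card (false ∷ S) = card S

_⊕_ : ∀ {N} → Vec ℕ N → Vec Bool N → Vec ℕ N
[] ⊕ [] = []
(x ∷ v) ⊕ (true ∷ S) = suc x ∷ (v ⊕ S)
(x ∷ v) ⊕ (false ∷ S) = x ∷ (v ⊕ S)

bump : ∀ {N} → Fin N → Vec ℕ N → Vec ℕ N
bump zero (x ∷ v) = suc x ∷ v
bump (suc c) (x ∷ v) = x ∷ bump c v

bump-comm : ∀ {N} (c d : Fin N) v → bump c (bump d v) ≡ bump d (bump c v)
bump-comm zero zero (x ∷ v) = refl
bump-comm zero (suc d) (x ∷ v) = refl
bump-comm (suc c) zero (x ∷ v) = refl
bump-comm (suc c) (suc d) (x ∷ v) = cong (x ∷_) (bump-comm c d v)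

⊕-comm : ∀ {N} (v : Vec ℕ N) S S′ → (v ⊕ S) ⊕ S′ ≡ (v ⊕ S′) ⊕ S
⊕-comm [] [] [] = refl
⊕-comm (x ∷ v) (true ∷ S) (true ∷ S′) = cong (_ ∷_) (⊕-comm v S S′)
⊕-comm (x ∷ v) (true ∷ S) (false ∷ S′) = cong (_ ∷_) (⊕-comm v S S′)
⊕-comm (x ∷ v) (false ∷ S) (true ∷ S′) = cong (_ ∷_) (⊕-comm v S S′)
⊕-comm (x ∷ v) (false ∷ S) (false ∷ S′) = cong (_ ∷_) (⊕-comm v S S′)

mem nmem : ∀ {N} → Fin N → Vec Bool N → ℤ
mem c S = 𝟙 (lookup S c)
nmem c S = 1ℤ - mem c S

insert : ∀ {N} → Fin N → Vec Bool N → Vec Bool N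
insert c S = S [ c ]≔ true

card-insert : ∀ {N} (c : Fin N) S → lookup S c ≡ false → card (insert c S) ≡ suc (card S)
card-insert zero (false ∷ S) h = refl
card-insert (suc c) (true ∷ S) h = cong suc (card-insert c S h)
card-insert (suc c) (false ∷ S) h = card-insert c S h

⊕-insert : ∀ {N} (c : Fin N) v S → lookup S c ≡ false → v ⊕ insert c S ≡ bump c v ⊕ S
⊕-insert zero (x ∷ v) (false ∷ S) h = refl
⊕-insert (suc c) (x ∷ v) (true ∷ S) h = cong (_ ∷_) (⊕-insert c v S h)
⊕-insert (suc c) (x ∷ v) (false ∷ S) h = cong (_ ∷_) (⊕-insert c v S h)

-- Adding c is a bijection from the sets that miss c onto those that contain it.
∑-insert : ∀ {N} (c : Fin N) (g : Vec Bool N → ℤ) →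
  ∑ (subsets N) (λ S → mem c S * g S) ≡ ∑ (subsets N) (λ S → nmem c S * g (insert c S))
∑-insert {suc N} zero g = begin
  ∑ (subsets (suc N)) (λ S → mem zero S * g S) ≡⟨ ∑-subsets N _ ⟩
  ∑ (subsets N) (λ S → 1ℤ * g (true ∷ S)) + ∑ (subsets N) (λ S → 0ℤ * g (false ∷ S))
    ≡⟨ ℤₚ.+-comm (∑ (subsets N) (λ S → 1ℤ * g (true ∷ S))) _ ⟩
  ∑ (subsets N) (λ S → 0ℤ * g (true ∷ S)) + ∑ (subsets N) (λ S → 1ℤ * g (true ∷ S))
    ≡⟨ ∑-subsets N (λ S → nmem zero S * g (insert zero S)) ⟨
  ∑ (subsets (suc N)) (λ S → nmem zero S * g (insert zero S)) ∎
∑-insert {suc N} (suc c) g = begin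
  ∑ (subsets (suc N)) (λ S → mem (suc c) S * g S) ≡⟨ ∑-subsets N _ ⟩
  ∑ (subsets N) (λ S → mem c S * g (true ∷ S)) + ∑ (subsets N) (λ S → mem c S * g (false ∷ S))
    ≡⟨ cong₂ _+_ (∑-insert c _) (∑-insert c _) ⟩
  ∑ (subsets N) (λ S → nmem c S * g (true ∷ insert c S)) + ∑ (subsets N) (λ S → nmem c S * g (false ∷ insert c S))
    ≡⟨ ∑-subsets N (λ S → nmem (suc c) S * g (insert (suc c) S)) ⟨
  ∑ (subsets (suc N)) (λ S → nmem (suc c) S * g (insert (suc c) S)) ∎

-- Deleting c from S lowers the cardinality by one and moves a factor x_c into the base exponent.
-- The factor `h` must be blind to c; it is taken to be 1 or the membership of another colour.
∑-remove : ∀ {N} (c : Fin N) (h : Vec Bool N → ℤ) → (∀ S → h (insert c S) ≡ h S) →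
  (G : ℕ → Vec ℕ N → ℤ) (v : Vec ℕ N) →
  ∑ (subsets N) (λ S → mem c S * (h S * G (card S) (v ⊕ S))) ≡
  ∑ (subsets N) (λ S → nmem c S * (h S * G (suc (card S)) (bump c v ⊕ S)))
∑-remove {N} c h inv G v = trans (∑-insert c _) (∑-cong (subsets N) step)
  where
  step : ∀ S → nmem c S * (h (insert c S) * G (card (insert c S)) (v ⊕ insert c S)) ≡
               nmem c S * (h S * G (suc (card S)) (bump c v ⊕ S))
  step S with lookup S c in p
  -- Here `nmem c S` is 0, so the value of `insert` is irrelevant.
  ... | true = refl
  ... | false rewrite inv S | card-insert c S p | ⊕-insert c v S p = refl

card-mem : ∀ {N} (S : Vec Bool N) → ∑ (allFin N) (λ c → mem c S) ≡ + card S
card-mem [] = ∑-[] _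
card-mem {suc N} (true ∷ S) = trans (∑-allFin N _) (cong (λ z → 1ℤ + z) (card-mem S))
card-mem {suc N} (false ∷ S) = trans (∑-allFin N _) (trans (ℤₚ.+-identityˡ _) (card-mem S))

mem-insert : ∀ {N} (c d : Fin N) → c ≢ d → ∀ S → mem d (insert c S) ≡ mem d S
mem-insert zero zero p S = ⊥-elim (p refl)
mem-insert zero (suc d) p (b ∷ S) = refl
mem-insert (suc c) zero p (b ∷ S) = refl
mem-insert (suc c) (suc d) p (b ∷ S) = mem-insert c d (p ∘ cong suc) S

∑-empty : ∀ {N} (G : ℕ → Vec ℕ N → ℤ) (v : Vec ℕ N) →
  ∑ (subsets N) (λ S → 𝟙 (card S ≡ᵇ 0) * G (card S) (v ⊕ S)) ≡ G 0 v
∑-empty {zero} G [] = trans (∑-singleton [] _) (ℤₚ.*-identityˡ (G 0 []))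
∑-empty {suc N} G (x ∷ v) = begin
  ∑ (subsets (suc N)) (λ S → 𝟙 (card S ≡ᵇ 0) * G (card S) ((x ∷ v) ⊕ S)) ≡⟨ ∑-subsets N _ ⟩
  ∑ (subsets N) (λ S → 0ℤ) + ∑ (subsets N) (λ S → 𝟙 (card S ≡ᵇ 0) * G (card S) (x ∷ (v ⊕ S)))
    ≡⟨ cong₂ _+_ (∑-zero (subsets N)) (∑-empty (λ k w → G k (x ∷ w)) v) ⟩
  0ℤ + G 0 (x ∷ v) ≡⟨ ℤₚ.+-identityˡ _ ⟩
  G 0 (x ∷ v) ∎

-- Elementary symmetric functions as operators

-- Coefficient extraction is dualised: a polynomial f acts on functions of an exponent vector v by
-- φ ↦ (v ↦ Σ_β [x^β] f · φ (v + β)).  Thus bump c acts as x_c, e k as e_k, and E φ I as e_I.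
Series : ℕ → Set
Series N = Vec ℕ N → ℤ

e : ℕ → Series N → Series N
e {N} k F v = ∑ (subsets N) (λ S → 𝟙 (card S ≡ᵇ k) * F (v ⊕ S))

e-cong : ∀ k {F G : Series N} → (∀ v → F v ≡ G v) → ∀ v → e k F v ≡ e k G v
e-cong k h v = ∑-cong (subsets _) (λ S → cong (λ z → 𝟙 (card S ≡ᵇ k) * z) (h (v ⊕ S)))

e-* : ∀ k (c : ℤ) (F : Series N) v → e k (λ v → c * F v) v ≡ c * e k F v
e-* {N} k c F v = trans
  (∑-cong (subsets N) (λ S → *-left-comm (𝟙 (card S ≡ᵇ k)) c (F (v ⊕ S))))
  (∑-*ˡ (subsets N) c _)

e-∑ : ∀ k (xs : List A) (f : A → Series N) v →
  e k (λ v → ∑ xs (λ x → f x v)) v ≡ ∑ xs (λ x → e k (f x) v)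
e-∑ {N = N} k xs f v = trans
  (∑-cong (subsets N) (λ S → sym (∑-*ˡ xs (𝟙 (card S ≡ᵇ k)) (λ x → f x (v ⊕ S)))))
  (∑-swap (subsets N) xs _)

e-∑* : ∀ k (xs : List A) (c : A → ℤ) (f : A → Series N) v →
  e k (λ v → ∑ xs (λ x → c x * f x v)) v ≡ ∑ xs (λ x → c x * e k (f x) v)
e-∑* k xs c f v = trans (e-∑ k xs (λ x v → c x * f x v) v)
  (∑-cong xs (λ x → e-* k (c x) (f x) v))

e-comm : ∀ j k (F : Series N) v → e j (e k F) v ≡ e k (e j F) v
e-comm {N} j k F v = trans
  (∑-swap-* (subsets N) (subsets N) (λ S → 𝟙 (card S ≡ᵇ j)) (λ S → 𝟙 (card S ≡ᵇ k)) (λ S S′ → F ((v ⊕ S) ⊕ S′)))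
  (∑-cong (subsets N) (λ S′ → cong (λ z → 𝟙 (card S′ ≡ᵇ k) * z)
    (∑-cong (subsets N) (λ S → cong (λ w → 𝟙 (card S ≡ᵇ j) * F w) (⊕-comm v S S′)))))

E : Series N → List ℕ → Series N
E = foldr e

-- Multiplications commute, so a fixed factor e_j can be stored in the test function; this is how
-- trailing parts 2 become `e 2 φ`.
e-E : ∀ j (φ : Series N) I v → e j (E φ I) v ≡ E (e j φ) I v
e-E j φ [] v = refl
e-E j φ (k ∷ I) v = trans (e-comm j k (E φ I) v) (e-cong k (e-E j φ I) v)

-- Compositions sorted by their first part

-- The first argument is fuel; it bounds the number of parts.
comps : ℕ → ℕ → List (List ℕ)
comps f zero = [ [] ]
comps zero (suc n) = []
comps (suc f) (suc n) = concatMap (λ a → map (suc a ∷_) (comps f (n ∸ a))) (upTo (suc n))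

comps-fuel : ∀ f f′ n → n ≤ f → n ≤ f′ → comps f n ≡ comps f′ n
comps-fuel f f′ zero p q = refl
comps-fuel (suc f) (suc f′) (suc n) (s≤s p) (s≤s q) = concatMap-cong
  (λ a → cong (map (suc a ∷_)) (comps-fuel f f′ (n ∸ a)
    (ℕₚ.≤-trans (ℕₚ.m∸n≤m n a) p) (ℕₚ.≤-trans (ℕₚ.m∸n≤m n a) q))) (upTo (suc n))

comp : ℕ → List (List ℕ)
comp n = comps n n

∑-comp-suc : ∀ n (h : List ℕ → ℤ) →
  ∑ (comp (suc n)) h ≡ ∑ (upTo (suc n)) (λ a → ∑ (comp (n ∸ a)) (λ I → h (suc a ∷ I)))
∑-comp-suc n h = trans (∑-concatMap (λ a → map (suc a ∷_) (comps n (n ∸ a))) (upTo (suc n)) h)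
  (∑-cong (upTo (suc n)) (λ a → trans (∑-map (suc a ∷_) (comps n (n ∸ a)) h)
    (cong (λ xs → ∑ xs (λ I → h (suc a ∷ I)))
      (comps-fuel n (n ∸ a) (n ∸ a) (ℕₚ.m∸n≤m n a) ℕₚ.≤-refl))))

-- F (n − k), and 0 when k > n.
τ : (ℕ → Series N) → ℕ → ℕ → Series N
τ F n zero = F n
τ F zero (suc k) v = 0ℤ
τ F (suc n) (suc k) = τ F n k

∑-upTo : ∀ n (f : ℕ → ℤ) → ∑ (upTo (suc n)) f ≡ f 0 + ∑ (upTo n) (f ∘ suc)
∑-upTo n f = trans (∑-∷ 0 _ f) (cong (λ z → f 0 + z)
  (trans (cong (λ xs → ∑ xs f) (sym (map-applyUpTo id suc n))) (∑-map suc (upTo n) f)))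

∑-upTo-τ : ∀ n k (g : ℕ → ℤ) (F : ℕ → Series N) v →
  ∑ (upTo (suc n)) (λ a → 𝟙 (k ≡ᵇ a) * (g a * F (n ∸ a) v)) ≡ g k * τ F n k v
∑-upTo-τ n zero g F v = begin
  ∑ (upTo (suc n)) (λ a → 𝟙 (0 ≡ᵇ a) * (g a * F (n ∸ a) v)) ≡⟨ ∑-upTo n _ ⟩
  1ℤ * (g 0 * F n v) + ∑ (upTo n) (λ _ → 0ℤ)
    ≡⟨ cong₂ _+_ (ℤₚ.*-identityˡ (g 0 * F n v)) (∑-zero (upTo n)) ⟩
  g 0 * F n v + 0ℤ ≡⟨ ℤₚ.+-identityʳ _ ⟩
  g 0 * F n v ∎
∑-upTo-τ zero (suc k) g F v = begin
  ∑ (upTo 1) (λ a → 𝟙 (suc k ≡ᵇ a) * (g a * F (0 ∸ a) v)) ≡⟨ ∑-upTo 0 _ ⟩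
  0ℤ + ∑ [] _ ≡⟨ ℤₚ.+-identityˡ _ ⟩
  ∑ [] (λ a → 𝟙 (suc k ≡ᵇ suc a) * (g (suc a) * F (0 ∸ suc a) v)) ≡⟨ ∑-[] _ ⟩
  0ℤ ≡⟨ ℤₚ.*-zeroʳ (g (suc k)) ⟨
  g (suc k) * 0ℤ ∎
∑-upTo-τ (suc n) (suc k) g F v = trans (∑-upTo (suc n) _)
  (trans (ℤₚ.+-identityˡ _) (∑-upTo-τ n k (g ∘ suc) F v))

-- Σ_k g(k) e_k F_{n−k}, organised as a sum over subsets so that no range condition on k is needed.
GS : (ℕ → Series N) → ℕ → (ℕ → ℤ) → Series N
GS {N} F n g v = ∑ (subsets N) (λ S → g (card S) * τ F n (card S) (v ⊕ S))

-- Subsets are grouped by cardinality a + 1. The empty set corresponds to no first part, and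
-- `g 0 ≡ 0ℤ` removes it.
∑-first : ∀ n (g : ℕ → ℤ) → g 0 ≡ 0ℤ → (F : ℕ → Series N) → ∀ v →
  ∑ (upTo (suc n)) (λ a → g (suc a) * e (suc a) (F (n ∸ a)) v) ≡ GS F (suc n) g v
∑-first {N} n g g0 F v = begin
  ∑ (upTo (suc n)) (λ a → g (suc a) * e (suc a) (F (n ∸ a)) v)
    ≡⟨ ∑-cong (upTo (suc n)) (λ a → sym (∑-*ˡ (subsets N) (g (suc a)) _)) ⟩
  ∑ (upTo (suc n)) (λ a → ∑ (subsets N) (λ S → g (suc a) * (𝟙 (card S ≡ᵇ suc a) * F (n ∸ a) (v ⊕ S))))
    ≡⟨ ∑-swap (upTo (suc n)) (subsets N) _ ⟩
  ∑ (subsets N) (λ S → ∑ (upTo (suc n)) (λ a → g (suc a) * (𝟙 (card S ≡ᵇ suc a) * F (n ∸ a) (v ⊕ S))))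
    ≡⟨ ∑-cong (subsets N) (λ S → trans
         (∑-cong (upTo (suc n)) (λ a → *-left-comm (g (suc a)) (𝟙 (card S ≡ᵇ suc a)) _))
         (by-card (card S) (v ⊕ S))) ⟩
  GS F (suc n) g v ∎
  where
  by-card : ∀ k w → ∑ (upTo (suc n)) (λ a → 𝟙 (k ≡ᵇ suc a) * (g (suc a) * F (n ∸ a) w)) ≡ g k * τ F (suc n) k w
  by-card zero w = trans (∑-zero (upTo (suc n))) (cong (_* F (suc n) w) (sym g0))
  by-card (suc k) w = ∑-upTo-τ n k (g ∘ suc) F w

weighted : (List ℕ → ℤ) → Series N → ℕ → Series N
weighted c φ m v = ∑ (comp m) (λ I → c I * E φ I v)

-- The common source of every recursion below: a weight that factors into a function of the first
-- part and a weight of the tail becomes a `GS` sum.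
weighted-suc : ∀ n (g : ℕ → ℤ) → g 0 ≡ 0ℤ → (h c : List ℕ → ℤ) →
  (∀ s I → h (s ∷ I) ≡ g s * c I) → ∀ (φ : Series N) v →
  weighted h φ (suc n) v ≡ GS (weighted c φ) (suc n) g v
weighted-suc n g g0 h c hyp φ v = begin
  weighted h φ (suc n) v ≡⟨ ∑-comp-suc n _ ⟩
  ∑ (upTo (suc n)) (λ a → ∑ (comp (n ∸ a)) (λ I → h (suc a ∷ I) * e (suc a) (E φ I) v))
    ≡⟨ ∑-cong (upTo (suc n)) (λ a → trans
         (∑-cong (comp (n ∸ a)) (λ I → trans
           (cong (_* e (suc a) (E φ I) v) (hyp (suc a) I))
           (ℤₚ.*-assoc (g (suc a)) (c I) _)))
         (trans (∑-*ˡ (comp (n ∸ a)) (g (suc a)) _)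
           (cong (λ z → g (suc a) * z) (sym (e-∑* (suc a) (comp (n ∸ a)) c (E φ) v))))) ⟩
  ∑ (upTo (suc n)) (λ a → g (suc a) * e (suc a) (weighted c φ (n ∸ a)) v)
    ≡⟨ ∑-first n g g0 (weighted c φ) v ⟩
  GS (weighted c φ) (suc n) g v ∎

weighted-+ : ∀ (h c : List ℕ → ℤ) (φ : Series N) m v →
  weighted (λ I → h I + c I) φ m v ≡ weighted h φ m v + weighted c φ m v
weighted-+ h c φ m v = trans (∑-cong (comp m) (λ I → ℤₚ.*-distribʳ-+ (E φ I v) (h I) (c I)))
  (∑-+ (comp m) _ _)

weighted-cong : ∀ {h c : List ℕ → ℤ} → (∀ I → h I ≡ c I) → ∀ (φ : Series N) m v →
  weighted h φ m v ≡ weighted c φ m v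
weighted-cong p φ m v = ∑-cong (comp m) (λ I → cong (_* E φ I v) (p I))

-- The series T_n and its recursion

u : List ℕ → ℤ
u I = + product (map (_∸ 1) I)

-- T_n in the notation above: Σ_{I ⊨ n} (i_1 − 1)(i_2 − 1)⋯ e_I.
P : Series N → ℕ → Series N
P = weighted u

-- Truncated subtraction makes `pred 0` equal to 0, so the empty set drops out of `GS` sums with
-- this weight.
pred : ℕ → ℤ
pred s = + (s ∸ 1)

P-suc : ∀ (φ : Series N) n v → P φ (suc n) v ≡ GS (P φ) (suc n) pred v
P-suc φ n v = weighted-suc n pred refl u u (λ s I → ℤₚ.pos-* (s ∸ 1) (product (map (_∸ 1) I))) φ v

P-zero : ∀ (φ : Series N) v → P φ 0 v ≡ φ v
P-zero φ v = trans (∑-singleton [] _) (ℤₚ.*-identityˡ (φ v))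

τ-cong : ∀ n k {F G : ℕ → Series N} → (∀ m → m ≤ n → ∀ v → F m v ≡ G m v) → ∀ v →
  τ F n k v ≡ τ G n k v
τ-cong n zero h v = h n ℕₚ.≤-refl v
τ-cong zero (suc k) h v = refl
τ-cong (suc n) (suc k) h v = τ-cong n k (λ m p → h m (ℕₚ.m≤n⇒m≤1+n p)) v

GS-τ : ∀ (F : ℕ → Series N) n g (G : ℕ → Series N) m h →
  (∀ k v → g k * τ F n k v ≡ h k * τ G m k v) → ∀ v → GS F n g v ≡ GS G m h v
GS-τ F n g G m h p v = ∑-cong (subsets _) (λ S → p (card S) (v ⊕ S))

GS-cong : ∀ {F G : ℕ → Series N} n g → (∀ m → m ≤ n → ∀ v → F m v ≡ G m v) → ∀ v →
  GS F n g v ≡ GS G n g v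
GS-cong {F = F} {G} n g h = GS-τ F n g G n g (λ k v → cong (λ z → g k * z) (τ-cong n k h v))

-- The value at `suc n` occurs only for the empty set, whose weight is 0. Agreement up to n
-- therefore suffices, which is what strong induction on the degree supplies.
GS-cong-suc : ∀ {F G : ℕ → Series N} n g → g 0 ≡ 0ℤ → (∀ m → m ≤ n → ∀ v → F m v ≡ G m v) → ∀ v →
  GS F (suc n) g v ≡ GS G (suc n) g v
GS-cong-suc {F = F} {G} n g g0 h = GS-τ F (suc n) g G (suc n) g λ where
  zero v → trans (cong (_* F (suc n) v) g0) (cong (_* G (suc n) v) (sym g0))
  (suc k) v → cong (λ z → g (suc k) * z) (τ-cong n k h v)

GS-weight : ∀ (F : ℕ → Series N) n {g h : ℕ → ℤ} → (∀ s → g s ≡ h s) → ∀ v → GS F n g v ≡ GS F n h v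
GS-weight F n {g} {h} p = GS-τ F n g F n h (λ k v → cong (_* τ F n k v) (p k))

GS-+ : ∀ (F : ℕ → Series N) n g h v → GS F n (λ s → g s + h s) v ≡ GS F n g v + GS F n h v
GS-+ F n g h v = trans
  (∑-cong (subsets _) (λ S → ℤₚ.*-distribʳ-+ (τ F n (card S) (v ⊕ S)) (g (card S)) (h (card S))))
  (∑-+ (subsets _) _ _)

GS-* : ∀ (F : ℕ → Series N) n c g v → GS F n (λ s → c * g s) v ≡ c * GS F n g v
GS-* F n c g v = trans
  (∑-cong (subsets _) (λ S → ℤₚ.*-assoc c (g (card S)) (τ F n (card S) (v ⊕ S))))
  (∑-*ˡ (subsets _) c _)

GS-single : ∀ (F : ℕ → Series N) j n v → GS F (j ℕ.+ n) (λ s → 𝟙 (s ≡ᵇ j)) v ≡ e j (F n) v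
GS-single F j n v = ∑-cong (subsets _) (λ S → lem j (card S) (v ⊕ S))
  where
  lem : ∀ j k w → 𝟙 (k ≡ᵇ j) * τ F (j ℕ.+ n) k w ≡ 𝟙 (k ≡ᵇ j) * F n w
  lem zero zero w = refl
  lem zero (suc k) w = refl
  lem (suc j) zero w = refl
  lem (suc j) (suc k) w = lem j k w

e-τ : ∀ j (F : ℕ → Series N) n k v → e j (τ F n k) v ≡ τ (λ m → e j (F m)) n k v
e-τ j F n zero v = refl
e-τ j F zero (suc k) v = trans (∑-cong (subsets _) (λ S → ℤₚ.*-zeroʳ (𝟙 (card S ≡ᵇ j)))) (∑-zero (subsets _))
e-τ j F (suc n) (suc k) v = e-τ j F n k v

e-P : ∀ j (φ : Series N) n v → e j (P φ n) v ≡ P (e j φ) n v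
e-P j φ n v = trans (e-∑* j (comp n) u (E φ) v) (∑-cong (comp n) (λ I → cong (λ z → u I * z) (e-E j φ I v)))

e-GS : ∀ j (φ : Series N) n g v → e j (GS (P φ) n g) v ≡ GS (P (e j φ)) n g v
e-GS {N} j φ n g v = begin
  e j (GS (P φ) n g) v
    ≡⟨ e-∑* j (subsets N) (g ∘ card) (λ S v → τ (P φ) n (card S) (v ⊕ S)) v ⟩
  ∑ (subsets N) (λ S → g (card S) * e j (λ v → τ (P φ) n (card S) (v ⊕ S)) v)
    ≡⟨ ∑-cong (subsets N) (λ S → cong (λ z → g (card S) * z) (step S)) ⟩
  GS (P (e j φ)) n g v ∎
  where
  step : ∀ S → e j (λ v → τ (P φ) n (card S) (v ⊕ S)) v ≡ τ (P (e j φ)) n (card S) (v ⊕ S)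
  step S = trans
    (∑-cong (subsets N) (λ S′ → cong (λ w → 𝟙 (card S′ ≡ᵇ j) * τ (P φ) n (card S) w) (⊕-comm v S′ S)))
    (trans (e-τ j (P φ) n (card S) (v ⊕ S)) (τ-cong n (card S) (λ m _ → e-P j φ m) (v ⊕ S)))

-- Compositions ending in 2

-- A condition on the tail after i_1. An empty tail is accepted because the last part is then i_1,
-- whose own bound is imposed separately.
lastOk : List ℕ → Bool
lastOk [] = true
lastOk (i ∷ I) = lastGe 3 (i ∷ I)

-- This splits the weight of T_m by the last part. A last part 1 already gives the factor 0 in `u`,
-- so what `u₃` omits ends in exactly 2.
u₃ u₂ : List ℕ → ℤ
u₃ I = u I * 𝟙 (lastOk I)
u₂ I = u I - u₃ I

-- Prepending a part keeps the last part unless the tail is empty. Since `u₂ []` is 0, the one-part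
-- composition 2 enters through the extra summand.
u₂-∷ : ∀ s I → u₂ (s ∷ I) ≡ pred s * u₂ I + 𝟙 (s ≡ᵇ 2) * 𝟙 (null I)
u₂-∷ 0 [] = refl
u₂-∷ 1 [] = refl
u₂-∷ 2 [] = refl
u₂-∷ (suc (suc (suc s))) [] = lem (+ (suc (suc s) ℕ.* 1)) (pred (suc (suc (suc s))))
  where
  lem : ∀ x y → x - x * 1ℤ ≡ y * 0ℤ + 0ℤ
  lem = solve-∀
u₂-∷ s (j ∷ J) = begin
  u (s ∷ j ∷ J) - u (s ∷ j ∷ J) * t ≡⟨ cong (λ x → x - x * t) (ℤₚ.pos-* (s ∸ 1) _) ⟩
  pred s * u (j ∷ J) - pred s * u (j ∷ J) * t ≡⟨ lem (pred s) (u (j ∷ J)) t (𝟙 (s ≡ᵇ 2)) ⟩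
  pred s * (u (j ∷ J) - u (j ∷ J) * t) + 𝟙 (s ≡ᵇ 2) * 0ℤ ∎
  where
  t = 𝟙 (lastGe 3 (j ∷ J))
  lem : ∀ p x t b → p * x - p * x * t ≡ p * (x - x * t) + b * 0ℤ
  lem = solve-∀

shift₂ : (ℕ → Series N) → ℕ → Series N
shift₂ F 0 v = 0ℤ
shift₂ F 1 v = 0ℤ
shift₂ F (suc (suc n)) = F n

τ-shift₂ : ∀ (F : ℕ → Series N) n k v → τ (shift₂ F) (suc (suc n)) k v ≡ τ F n k v
τ-shift₂ F n zero v = refl
τ-shift₂ F zero 1 v = refl
τ-shift₂ F zero 2 v = refl
τ-shift₂ F zero (suc (suc (suc k))) v = refl
τ-shift₂ F (suc n) (suc k) v = τ-shift₂ F n k v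

GS-shift₂ : ∀ (F : ℕ → Series N) n g v → GS (shift₂ F) (suc (suc n)) g v ≡ GS F n g v
GS-shift₂ F n g = GS-τ (shift₂ F) (suc (suc n)) g F n g (λ k v → cong (λ z → g k * z) (τ-shift₂ F n k v))

onlyEmpty : Series N → ℕ → Series N
onlyEmpty = weighted (𝟙 ∘ null)

onlyEmpty-zero : ∀ (φ : Series N) v → onlyEmpty φ 0 v ≡ φ v
onlyEmpty-zero φ v = trans (∑-singleton [] _) (ℤₚ.*-identityˡ (φ v))

onlyEmpty-suc : ∀ (φ : Series N) n v → onlyEmpty φ (suc n) v ≡ 0ℤ
onlyEmpty-suc φ n v = trans (∑-comp-suc n _)
  (trans (∑-cong (upTo (suc n)) (λ a → ∑-zero (comp (n ∸ a)))) (∑-zero (upTo (suc n))))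

GS-zero : ∀ (F : ℕ → Series N) n g → (∀ k v → g k * τ F n k v ≡ 0ℤ) → ∀ v → GS F n g v ≡ 0ℤ
GS-zero F n g p v = trans (∑-cong (subsets _) (λ S → p (card S) (v ⊕ S))) (∑-zero (subsets _))

weighted-u₂-suc : ∀ (φ : Series N) n v →
  weighted u₂ φ (suc n) v ≡ GS (weighted u₂ φ) (suc n) pred v + GS (onlyEmpty φ) (suc n) (λ s → 𝟙 (s ≡ᵇ 2)) v
weighted-u₂-suc φ n v = begin
  weighted u₂ φ (suc n) v ≡⟨ weighted-cong {h = u₂} {λ I → h₁ I + h₂ I} split φ (suc n) v ⟩
  weighted (λ I → h₁ I + h₂ I) φ (suc n) v ≡⟨ weighted-+ h₁ h₂ φ (suc n) v ⟩
  weighted h₁ φ (suc n) v + weighted h₂ φ (suc n) v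
    ≡⟨ cong₂ _+_ (weighted-suc n pred refl h₁ u₂ (λ _ _ → refl) φ v)
         (weighted-suc n (λ s → 𝟙 (s ≡ᵇ 2)) refl h₂ (𝟙 ∘ null) (λ _ _ → refl) φ v) ⟩
  GS (weighted u₂ φ) (suc n) pred v + GS (onlyEmpty φ) (suc n) (λ s → 𝟙 (s ≡ᵇ 2)) v ∎
  where
  h₁ h₂ : List ℕ → ℤ
  h₁ [] = 0ℤ
  h₁ (s ∷ I) = pred s * u₂ I
  h₂ [] = 0ℤ
  h₂ (s ∷ I) = 𝟙 (s ≡ᵇ 2) * 𝟙 (null I)
  split : ∀ I → u₂ I ≡ h₁ I + h₂ I
  split [] = refl
  split (s ∷ I) = u₂-∷ s I

-- Compositions weighted by u₂ are those ending in 2.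
weighted-u₂ : ∀ (φ : Series N) m v → weighted u₂ φ m v ≡ shift₂ (P (e 2 φ)) m v
weighted-u₂ φ m = bounded m m ℕₚ.≤-refl
  where
  bounded : ∀ n m → m ≤ n → ∀ v → weighted u₂ φ m v ≡ shift₂ (P (e 2 φ)) m v
  bounded n zero p v = ∑-singleton [] _
  bounded (suc n) (suc m) (s≤s p) v = begin
    weighted u₂ φ (suc m) v ≡⟨ weighted-u₂-suc φ m v ⟩
    GS (weighted u₂ φ) (suc m) pred v + GS (onlyEmpty φ) (suc m) (λ s → 𝟙 (s ≡ᵇ 2)) v
      ≡⟨ cong (_+ GS (onlyEmpty φ) (suc m) (λ s → 𝟙 (s ≡ᵇ 2)) v)
           (GS-cong-suc m pred refl (λ k q → bounded n k (ℕₚ.≤-trans q p)) v) ⟩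
    GS (shift₂ (P (e 2 φ))) (suc m) pred v + GS (onlyEmpty φ) (suc m) (λ s → 𝟙 (s ≡ᵇ 2)) v ≡⟨ step m ⟩
    shift₂ (P (e 2 φ)) (suc m) v ∎
    where
    -- The inhomogeneous term lives in degree 2 only, where it supplies the initial value `e 2 φ`.
    -- In degree 1 everything vanishes, and from degree 3 on this is the recursion for T shifted by
    -- 2.
    step : ∀ m → GS (shift₂ (P (e 2 φ))) (suc m) pred v + GS (onlyEmpty φ) (suc m) (λ s → 𝟙 (s ≡ᵇ 2)) v
      ≡ shift₂ (P (e 2 φ)) (suc m) v
    step 0 = cong₂ _+_
      (GS-zero (shift₂ (P (e 2 φ))) 1 pred (λ where
        0 v → refl
        1 v → refl
        (suc (suc k)) v → ℤₚ.*-zeroʳ (pred (suc (suc k)))) v)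
      (GS-zero (onlyEmpty φ) 1 (λ s → 𝟙 (s ≡ᵇ 2)) (λ where
        0 v → refl
        1 v → refl
        (suc (suc k)) v → ℤₚ.*-zeroʳ (𝟙 (k ≡ᵇ 0))) v)
    step 1 = begin
      GS (shift₂ (P (e 2 φ))) 2 pred v + GS (onlyEmpty φ) 2 (λ s → 𝟙 (s ≡ᵇ 2)) v
        ≡⟨ cong₂ _+_ (trans (GS-shift₂ (P (e 2 φ)) 0 pred v)
             (GS-zero (P (e 2 φ)) 0 pred (λ where
               0 v → refl
               (suc k) v → ℤₚ.*-zeroʳ (pred (suc k))) v))
             (trans (GS-single (onlyEmpty φ) 2 0 v) (e-cong 2 (onlyEmpty-zero φ) v)) ⟩
      0ℤ + e 2 φ v ≡⟨ ℤₚ.+-identityˡ _ ⟩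
      e 2 φ v ≡⟨ P-zero (e 2 φ) v ⟨
      P (e 2 φ) 0 v ∎
    step (suc (suc m)) = begin
      GS (shift₂ (P (e 2 φ))) (3 ℕ.+ m) pred v + GS (onlyEmpty φ) (3 ℕ.+ m) (λ s → 𝟙 (s ≡ᵇ 2)) v
        ≡⟨ cong₂ _+_ (trans (GS-shift₂ (P (e 2 φ)) (suc m) pred v) (sym (P-suc (e 2 φ) m v)))
             (trans (GS-single (onlyEmpty φ) 2 (suc m) v)
               (trans (e-cong 2 (onlyEmpty-suc φ m) v)
                 (trans (∑-cong (subsets _) (λ S → ℤₚ.*-zeroʳ (𝟙 (card S ≡ᵇ 2)))) (∑-zero (subsets _))))) ⟩
      P (e 2 φ) (suc m) v + 0ℤ ≡⟨ ℤₚ.+-identityʳ _ ⟩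
      P (e 2 φ) (suc m) v ∎

GS-F-+ : ∀ (F G : ℕ → Series N) n g v → GS (λ m v → F m v + G m v) n g v ≡ GS F n g v + GS G n g v
GS-F-+ {N} F G n g v = trans
  (∑-cong (subsets N) (λ S → trans (cong (λ z → g (card S) * z) (τ-+ n (card S) (v ⊕ S)))
    (ℤₚ.*-distribˡ-+ (g (card S)) _ _)))
  (∑-+ (subsets N) _ _)
  where
  τ-+ : ∀ n k v → τ (λ m v → F m v + G m v) n k v ≡ τ F n k v + τ G n k v
  τ-+ n zero v = refl
  τ-+ zero (suc k) v = refl
  τ-+ (suc n) (suc k) v = τ-+ n k v

-- The three sums of the theorem

-- The dependence of each weight on the first part alone. In `g₁` the leading part 1 turns i_1 into
-- i_1 - 1; in `g₃` the factor i_1 of w_I has been multiplied into i_1 - 3 + 1/i_1.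
g₁ g₂ g₃ path cycle : ℕ → ℤ
g₁ s = 𝟙 (4 ≤ᵇ s) * (+ 2 * (+ s - + 3) * pred s)
g₂ s = 𝟙 (3 ≤ᵇ s) * (+ 2 * (+ 2 * + s - + 5) * + s)
g₃ s = 𝟙 (3 ≤ᵇ s) * (+ 4 * ((+ s - + 3) * + s + 1ℤ))
path s = + s
cycle s = + s * (+ s - 1ℤ)

-- w I / i_1
tailWeight : List ℕ → ℕ
tailWeight [] = 0
tailWeight (i ∷ I) = product (map (_∸ 1) I)

h₁ h₂ h₃ : List ℕ → ℤ
h₁ I = 𝟙 (firstGe 4 I) * (+ 2 * (+ first I - + 3) * + w (1 ∷ I))
h₂ I = 𝟙 (allPartsGe2 I ∧ firstGe 3 I ∧ lastGe 3 I) * (+ 2 * (+ 2 * + first I - + 5) * + w I)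
h₃ I = 𝟙 (allPartsGe2 I ∧ firstGe 3 I) * (+ 4 * ((+ first I - + 3) * + w I + + tailWeight I))

u-allGe2 : ∀ I → 𝟙 (allPartsGe2 I) * u I ≡ u I
u-allGe2 [] = refl
u-allGe2 (0 ∷ I) = refl
u-allGe2 (1 ∷ I) = refl
u-allGe2 (suc (suc s) ∷ I) = begin
  𝟙 (allPartsGe2 I) * + (suc s ℕ.* p) ≡⟨ cong (λ z → 𝟙 (allPartsGe2 I) * z) (ℤₚ.pos-* (suc s) p) ⟩
  𝟙 (allPartsGe2 I) * (+ suc s * u I) ≡⟨ *-left-comm (𝟙 (allPartsGe2 I)) (+ suc s) (u I) ⟩
  + suc s * (𝟙 (allPartsGe2 I) * u I) ≡⟨ cong (λ z → + suc s * z) (u-allGe2 I) ⟩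
  + suc s * u I ≡⟨ ℤₚ.pos-* (suc s) p ⟨
  u (suc (suc s) ∷ I) ∎
  where p = product (map (_∸ 1) I)

h₁-∷ : ∀ s I → h₁ (s ∷ I) ≡ g₁ s * u I
h₁-∷ s I = trans
  (cong (λ z → 𝟙 (4 ≤ᵇ s) * (+ 2 * (+ s - + 3) * z))
    (trans (cong +_ (ℕₚ.*-identityˡ _)) (ℤₚ.pos-* (s ∸ 1) (product (map (_∸ 1) I)))))
  (lem (𝟙 (4 ≤ᵇ s)) (+ 2 * (+ s - + 3)) (pred s) (u I))
  where
  lem : ∀ b x y z → b * (x * (y * z)) ≡ b * (x * y) * z
  lem = solve-∀

h₂-∷ : ∀ s I → h₂ (s ∷ I) ≡ g₂ s * u₃ I
h₂-∷ 0 I = refl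
h₂-∷ 1 I = refl
h₂-∷ 2 I = cong (λ b → 𝟙 b * (+ 2 * (+ 2 * + 2 - + 5) * + w (2 ∷ I))) (∧-zeroʳ (allPartsGe2 I))
h₂-∷ s@(suc (suc (suc k))) I = begin
  𝟙 (allPartsGe2 I ∧ lastGe 3 (s ∷ I)) * (c * + (s ℕ.* p))
    ≡⟨ cong₂ (λ a b → a * (c * b)) (trans (𝟙-∧ (allPartsGe2 I) _) (cong (λ t → 𝟙 (allPartsGe2 I) * 𝟙 t) (last≡ I))) (ℤₚ.pos-* s p) ⟩
  𝟙 (allPartsGe2 I) * 𝟙 (lastOk I) * (c * (+ s * u I)) ≡⟨ lem (𝟙 (allPartsGe2 I)) (𝟙 (lastOk I)) c (+ s) (u I) ⟩
  1ℤ * (c * + s) * (𝟙 (allPartsGe2 I) * u I * 𝟙 (lastOk I)) ≡⟨ cong (λ z → 1ℤ * (c * + s) * (z * 𝟙 (lastOk I))) (u-allGe2 I) ⟩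
  1ℤ * (c * + s) * (u I * 𝟙 (lastOk I)) ∎
  where
  p = product (map (_∸ 1) I)
  c = + 2 * (+ 2 * + s - + 5)
  last≡ : ∀ I → lastGe 3 (s ∷ I) ≡ lastOk I
  last≡ [] = refl
  last≡ (j ∷ J) = refl
  lem : ∀ a l c s u → a * l * (c * (s * u)) ≡ 1ℤ * (c * s) * (a * u * l)
  lem = solve-∀

h₃-∷ : ∀ s I → h₃ (s ∷ I) ≡ g₃ s * u I
h₃-∷ 0 I = refl
h₃-∷ 1 I = refl
h₃-∷ 2 I = cong (λ b → 𝟙 b * (+ 4 * ((+ 2 - + 3) * + w (2 ∷ I) + + tailWeight (2 ∷ I)))) (∧-zeroʳ (allPartsGe2 I))
h₃-∷ s@(suc (suc (suc k))) I = begin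
  𝟙 (allPartsGe2 I ∧ true) * (+ 4 * ((+ s - + 3) * + (s ℕ.* p) + u I))
    ≡⟨ cong₂ (λ a b → a * (+ 4 * ((+ s - + 3) * b + u I))) (trans (𝟙-∧ (allPartsGe2 I) true) (ℤₚ.*-identityʳ (𝟙 (allPartsGe2 I)))) (ℤₚ.pos-* s p) ⟩
  𝟙 (allPartsGe2 I) * (+ 4 * ((+ s - + 3) * (+ s * u I) + u I)) ≡⟨ lem (𝟙 (allPartsGe2 I)) (+ s) (u I) ⟩
  1ℤ * (+ 4 * ((+ s - + 3) * + s + 1ℤ)) * (𝟙 (allPartsGe2 I) * u I)
    ≡⟨ cong (λ z → 1ℤ * (+ 4 * ((+ s - + 3) * + s + 1ℤ)) * z) (u-allGe2 I) ⟩
  1ℤ * (+ 4 * ((+ s - + 3) * + s + 1ℤ)) * u I ∎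
  where
  p = product (map (_∸ 1) I)
  lem : ∀ a s u → a * (+ 4 * ((s - + 3) * (s * u) + u)) ≡ 1ℤ * (+ 4 * ((s - + 3) * s + 1ℤ)) * (a * u)
  lem = solve-∀

GS-linear : ∀ (F : ℕ → Series N) n a g b h c k v →
  GS F n (λ s → a * g s + (b * h s + c * k s)) v ≡ a * GS F n g v + (b * GS F n h v + c * GS F n k v)
GS-linear F n a g b h c k v = trans (GS-+ F n (λ s → a * g s) (λ s → b * h s + c * k s) v)
  (cong₂ _+_ (GS-* F n a g v) (trans (GS-+ F n (λ s → b * h s) (λ s → c * k s) v) (cong₂ _+_ (GS-* F n b h v) (GS-* F n c k v))))

[1] [2] : ℕ → ℤ
[1] s = 𝟙 (s ≡ᵇ 1)
[2] s = 𝟙 (s ≡ᵇ 2)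

-- The polynomial 4k(k - 1) - 6k equals 2k(2k - 5), the origin of 2i_1 - 5. Its values -6 at k = 1
-- and -4 at k = 2 are lost to the cutoff in `g₂` and reappear as corrections.
weights-a : ∀ s → + 4 * cycle s + (+ 6 * [1] s + + 4 * [2] s) ≡ 1ℤ * g₂ s + (+ 6 * path s + 0ℤ * path s)
weights-a 0 = refl
weights-a 1 = refl
weights-a 2 = refl
weights-a (suc (suc (suc k))) = lem (+ k)
  where
  lem : ∀ x → + 4 * ((+ 3 + x) * ((+ 3 + x) - 1ℤ)) + (+ 6 * 0ℤ + + 4 * 0ℤ) ≡
    1ℤ * (1ℤ * (+ 2 * (+ 2 * (+ 3 + x) - + 5) * (+ 3 + x))) + (+ 6 * (+ 3 + x) + 0ℤ * (+ 3 + x))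
  lem = solve-∀

-- Subtracting 6(k - 1) from 2k(k - 1) gives 2(k - 3)(k - 1), which is nonzero below 4 only at k = 2
-- among positive k. The weight 6(k - 1) sums to 6T_n and cancels the correction at k = 1 of
-- `weights-a`.
weights-b : ∀ s → + 2 * cycle s + (+ 2 * [2] s + 0ℤ * [2] s) ≡ 1ℤ * g₁ s + (+ 6 * pred s + 0ℤ * pred s)
weights-b 0 = refl
weights-b 1 = refl
weights-b 2 = refl
weights-b 3 = refl
weights-b (suc (suc (suc (suc k)))) = lem (+ k)
  where
  lem : ∀ x → + 2 * ((+ 4 + x) * ((+ 4 + x) - 1ℤ)) + (+ 2 * 0ℤ + 0ℤ * 0ℤ) ≡
    1ℤ * (1ℤ * (+ 2 * ((+ 4 + x) - + 3) * (+ 3 + x))) + (+ 6 * (+ 3 + x) + 0ℤ * (+ 3 + x))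
  lem = solve-∀

-- For k ≥ 3, 2k + 2k(2k - 5) is 4((k - 3)k + 1) + 4(k - 1), the origin of i_1 - 3 + 1/i_1. The last
-- summand cancels the correction at k = 2 of `weights-a`.
weights-c : ∀ s → + 2 * path s + (1ℤ * g₂ s + 0ℤ * g₂ s) ≡ 1ℤ * g₃ s + (+ 4 * pred s + + 2 * [1] s)
weights-c 0 = refl
weights-c 1 = refl
weights-c 2 = refl
weights-c (suc (suc (suc k))) = lem (+ k)
  where
  lem : ∀ x → + 2 * (+ 3 + x) + (1ℤ * (1ℤ * (+ 2 * (+ 2 * (+ 3 + x) - + 5) * (+ 3 + x))) + 0ℤ * (1ℤ * (+ 2 * (+ 2 * (+ 3 + x) - + 5) * (+ 3 + x)))) ≡
    1ℤ * (1ℤ * (+ 4 * (((+ 3 + x) - + 3) * (+ 3 + x) + 1ℤ))) + (+ 4 * (+ 2 + x) + + 2 * 0ℤ)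
  lem = solve-∀

e-GS-linear : ∀ j (F : ℕ → Series N) n a g b h c k v →
  e j (GS F n (λ s → a * g s + (b * h s + c * k s))) v ≡
  a * e j (GS F n g) v + (b * e j (GS F n h) v + c * e j (GS F n k) v)
e-GS-linear {N} j F n a g b h c k v = trans (e-cong j (GS-linear F n a g b h c k) v)
  (trans (∑-cong (subsets N) (λ S → lem (𝟙 (card S ≡ᵇ j)) a (G g S) b (G h S) c (G k S)))
  (trans (∑-+ (subsets N) _ _)
    (cong₂ _+_ (∑-*ˡ (subsets N) a _) (trans (∑-+ (subsets N) _ _)
      (cong₂ _+_ (∑-*ˡ (subsets N) b _) (∑-*ˡ (subsets N) c _))))))
  where
  G : (ℕ → ℤ) → Vec Bool N → ℤ
  G g S = GS F n g (v ⊕ S)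
  lem : ∀ t a x b y c z → t * (a * x + (b * y + c * z)) ≡ a * (t * x) + (b * (t * y) + c * (t * z))
  lem = solve-∀

E-append : ∀ (φ : Series N) I v → E φ (I ++ [ 2 ]) v ≡ E (e 2 φ) I v
E-append φ I v = cong (λ f → f v) (foldr-++ e φ I [ 2 ])

first-term : ∀ (φ : Series N) m v →
  ∑ (comp (suc m)) (λ I → h₁ I * E φ (1 ∷ I) v) ≡ e 1 (GS (P φ) (suc m) g₁) v
first-term φ m v = trans (sym (e-∑* 1 (comp (suc m)) h₁ (E φ) v))
  (e-cong 1 (weighted-suc m g₁ refl h₁ u h₁-∷ φ) v)

-- Dropping the bound on the last part adds the compositions whose tail ends in 2; by `weighted-u₂`
-- these form the same sum in degree lower by 2, tested against `e 2 φ`.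
second-term : ∀ (φ : Series N) m v →
  ∑ (comp (suc (suc m))) (λ I → h₂ I * E φ I v) + GS (P (e 2 φ)) m g₂ v ≡ GS (P φ) (suc (suc m)) g₂ v
second-term φ m v = begin
  weighted h₂ φ (suc (suc m)) v + GS (P (e 2 φ)) m g₂ v
    ≡⟨ cong₂ _+_ (weighted-suc (suc m) g₂ refl h₂ u₃ h₂-∷ φ v)
         (trans (sym (GS-shift₂ (P (e 2 φ)) m g₂ v))
           (sym (GS-cong {F = weighted u₂ φ} {shift₂ (P (e 2 φ))} (suc (suc m)) g₂ (λ k _ → weighted-u₂ φ k) v))) ⟩
  GS (weighted u₃ φ) (suc (suc m)) g₂ v + GS (weighted u₂ φ) (suc (suc m)) g₂ v
    ≡⟨ GS-F-+ (weighted u₃ φ) (weighted u₂ φ) (suc (suc m)) g₂ v ⟨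
  GS (λ k v → weighted u₃ φ k v + weighted u₂ φ k v) (suc (suc m)) g₂ v
    ≡⟨ GS-cong (suc (suc m)) g₂ (λ k _ v → trans (sym (weighted-+ u₃ u₂ φ k v))
         (weighted-cong {h = λ I → u₃ I + u₂ I} {u} (λ I → lem (u₃ I) (u I)) φ k v)) v ⟩
  GS (P φ) (suc (suc m)) g₂ v ∎
  where
  lem : ∀ x y → x + (y - x) ≡ y
  lem = solve-∀

third-term : ∀ (φ : Series N) m v →
  ∑ (comp (suc m)) (λ I → h₃ I * E φ (I ++ [ 2 ]) v) ≡ GS (P (e 2 φ)) (suc m) g₃ v
third-term φ m v = trans (∑-cong (comp (suc m)) (λ I → cong (λ z → h₃ I * z) (E-append φ I v)))
  (weighted-suc m g₃ refl h₃ u h₃-∷ (e 2 φ) v)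

-- With n = m + 2, the corrections are `X` = e_1 T_n, `Y` = e_2 T_{n-1} and `Z` = e_1 e_2 T_{n-2}.
-- Adding the three weight identities cancels them, together with the terms `G₂′` for compositions
-- ending in 2.
rhs-series : ∀ (φ : Series N) m v →
  ∑ (comp (2 ℕ.+ m)) (λ I → h₁ I * E φ (1 ∷ I) v)
  + ∑ (comp (3 ℕ.+ m)) (λ I → h₂ I * E φ I v)
  + ∑ (comp (1 ℕ.+ m)) (λ I → h₃ I * E φ (I ++ [ 2 ]) v)
  ≡ + 2 * e 1 (GS (P φ) (2 ℕ.+ m) cycle) v + + 4 * GS (P φ) (3 ℕ.+ m) cycle v
    + + 2 * e 2 (GS (P φ) (1 ℕ.+ m) path) v - + 6 * GS (P φ) (3 ℕ.+ m) path v
rhs-series {N} φ m v = begin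
  S₁ + S₂ + S₃ ≡⟨ cong₂ (λ a b → a + S₂ + b) (first-term φ (suc m) v) (third-term φ m v) ⟩
  B₁ + S₂ + B₃ ≡⟨ solve₁ B₁ S₂ B₃ C₁ C₂ P₁ P₂ G₂ G₂′ X Y Z eqa eqb eqc (second-term φ (suc m) v) ⟩
  + 2 * C₁ + + 4 * C₂ + + 2 * P₁ - + 6 * P₂ ∎
  where
  S₁ = ∑ (comp (2 ℕ.+ m)) (λ I → h₁ I * E φ (1 ∷ I) v)
  S₂ = ∑ (comp (3 ℕ.+ m)) (λ I → h₂ I * E φ I v)
  S₃ = ∑ (comp (1 ℕ.+ m)) (λ I → h₃ I * E φ (I ++ [ 2 ]) v)
  B₁ = e 1 (GS (P φ) (2 ℕ.+ m) g₁) v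
  B₃ = GS (P (e 2 φ)) (1 ℕ.+ m) g₃ v
  C₁ = e 1 (GS (P φ) (2 ℕ.+ m) cycle) v
  C₂ = GS (P φ) (3 ℕ.+ m) cycle v
  P₁ = e 2 (GS (P φ) (1 ℕ.+ m) path) v
  P₂ = GS (P φ) (3 ℕ.+ m) path v
  G₂ = GS (P φ) (3 ℕ.+ m) g₂ v
  G₂′ = GS (P (e 2 φ)) (1 ℕ.+ m) g₂ v
  X = e 1 (P φ (2 ℕ.+ m)) v
  Y = P (e 2 φ) (1 ℕ.+ m) v
  Z = e 1 (P (e 2 φ) m) v
  -- Summands with coefficient 0 pad the identities to the three-term shape of `GS-linear`.
  eqa : + 4 * C₂ + (+ 6 * X + + 4 * Y) ≡ 1ℤ * G₂ + (+ 6 * P₂ + 0ℤ * P₂)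
  eqa = trans (cong₂ (λ x y → + 4 * C₂ + (+ 6 * x + + 4 * y)) (sym (GS-single (P φ) 1 (2 ℕ.+ m) v))
      (trans (sym (e-P 2 φ (1 ℕ.+ m) v)) (sym (GS-single (P φ) 2 (1 ℕ.+ m) v))))
    (trans (sym (GS-linear (P φ) (3 ℕ.+ m) (+ 4) cycle (+ 6) [1] (+ 4) [2] v))
    (trans (GS-weight (P φ) (3 ℕ.+ m) weights-a v)
      (GS-linear (P φ) (3 ℕ.+ m) 1ℤ g₂ (+ 6) path 0ℤ path v)))
  eqb : + 2 * C₁ + (+ 2 * Z + 0ℤ * Z) ≡ 1ℤ * B₁ + (+ 6 * X + 0ℤ * X)
  eqb = trans (cong (λ z → + 2 * C₁ + (+ 2 * z + 0ℤ * z))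
      (e-cong 1 (λ v → trans (sym (e-P 2 φ m v)) (sym (GS-single (P φ) 2 m v))) v))
    (trans (sym (e-GS-linear 1 (P φ) (2 ℕ.+ m) (+ 2) cycle (+ 2) [2] 0ℤ [2] v))
    (trans (e-cong 1 (GS-weight (P φ) (2 ℕ.+ m) weights-b) v)
    (trans (e-GS-linear 1 (P φ) (2 ℕ.+ m) 1ℤ g₁ (+ 6) pred 0ℤ pred v)
      (cong (λ x → 1ℤ * B₁ + (+ 6 * x + 0ℤ * x)) (sym (e-cong 1 (P-suc φ (1 ℕ.+ m)) v))))))
  eqc : + 2 * P₁ + (1ℤ * G₂′ + 0ℤ * G₂′) ≡ 1ℤ * B₃ + (+ 4 * Y + + 2 * Z)
  eqc = trans (cong (λ z → + 2 * z + (1ℤ * G₂′ + 0ℤ * G₂′)) (e-GS 2 φ (1 ℕ.+ m) path v))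
    (trans (sym (GS-linear (P (e 2 φ)) (1 ℕ.+ m) (+ 2) path 1ℤ g₂ 0ℤ g₂ v))
    (trans (GS-weight (P (e 2 φ)) (1 ℕ.+ m) weights-c v)
    (trans (GS-linear (P (e 2 φ)) (1 ℕ.+ m) 1ℤ g₃ (+ 4) pred (+ 2) [1] v)
      (cong₂ (λ y z → 1ℤ * B₃ + (+ 4 * y + + 2 * z)) (sym (P-suc (e 2 φ) m v)) (GS-single (P (e 2 φ)) 1 m v)))))
  -- Stated over arbitrary integers so that the cancellation is pure linear algebra.
  solve₁ : ∀ B₁ S₂ B₃ C₁ C₂ P₁ P₂ G₂ G₂′ X Y Z →
    + 4 * C₂ + (+ 6 * X + + 4 * Y) ≡ 1ℤ * G₂ + (+ 6 * P₂ + 0ℤ * P₂) →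
    + 2 * C₁ + (+ 2 * Z + 0ℤ * Z) ≡ 1ℤ * B₁ + (+ 6 * X + 0ℤ * X) →
    + 2 * P₁ + (1ℤ * G₂′ + 0ℤ * G₂′) ≡ 1ℤ * B₃ + (+ 4 * Y + + 2 * Z) →
    S₂ + G₂′ ≡ G₂ →
    B₁ + S₂ + B₃ ≡ + 2 * C₁ + + 4 * C₂ + + 2 * P₁ - + 6 * P₂
  solve₁ B₁ S₂ B₃ C₁ C₂ P₁ P₂ G₂ G₂′ X Y Z a b c refl = begin
    B₁ + S₂ + B₃ ≡⟨ r₁ B₁ S₂ B₃ P₂ G₂′ X Y Z ⟩
    (1ℤ * B₁ + (+ 6 * X + 0ℤ * X)) + (1ℤ * (S₂ + G₂′) + (+ 6 * P₂ + 0ℤ * P₂)) + (1ℤ * B₃ + (+ 4 * Y + + 2 * Z))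
      - (+ 6 * X + + 6 * P₂ + G₂′ + + 4 * Y + + 2 * Z)
      ≡⟨ cong (λ z → z - (+ 6 * X + + 6 * P₂ + G₂′ + + 4 * Y + + 2 * Z)) (cong₂ _+_ (cong₂ _+_ b a) c) ⟨
    (+ 2 * C₁ + (+ 2 * Z + 0ℤ * Z)) + (+ 4 * C₂ + (+ 6 * X + + 4 * Y)) + (+ 2 * P₁ + (1ℤ * G₂′ + 0ℤ * G₂′))
      - (+ 6 * X + + 6 * P₂ + G₂′ + + 4 * Y + + 2 * Z) ≡⟨ r₂ C₁ C₂ P₁ P₂ G₂′ X Y Z ⟩
    + 2 * C₁ + + 4 * C₂ + + 2 * P₁ - + 6 * P₂ ∎
    where
    r₁ : ∀ B₁ S₂ B₃ P₂ G₂′ X Y Z → B₁ + S₂ + B₃ ≡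
      (1ℤ * B₁ + (+ 6 * X + 0ℤ * X)) + (1ℤ * (S₂ + G₂′) + (+ 6 * P₂ + 0ℤ * P₂)) + (1ℤ * B₃ + (+ 4 * Y + + 2 * Z))
      - (+ 6 * X + + 6 * P₂ + G₂′ + + 4 * Y + + 2 * Z)
    r₁ = solve-∀
    r₂ : ∀ C₁ C₂ P₁ P₂ G₂′ X Y Z →
      (+ 2 * C₁ + (+ 2 * Z + 0ℤ * Z)) + (+ 4 * C₂ + (+ 6 * X + + 4 * Y)) + (+ 2 * P₁ + (1ℤ * G₂′ + 0ℤ * G₂′))
      - (+ 6 * X + + 6 * P₂ + G₂′ + + 4 * Y + + 2 * Z) ≡ + 2 * C₁ + + 4 * C₂ + + 2 * P₁ - + 6 * P₂
    r₂ = solve-∀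

-- Transfer recursions for colourings of paths

eq-sym : ∀ (a b : Fin N) → eq a b ≡ eq b a
eq-sym a b = cong 𝟙 (==-sym a b)

eq-guard : ∀ (a b : Fin N) {x y : ℤ} → (a ≡ b → x ≡ y) → eq a b * x ≡ eq a b * y
eq-guard a b h with a Fin.≟ b
... | yes p = cong (λ z → 1ℤ * z) (h p)
... | no _ = refl

neq-≢ : ∀ (a b : Fin N) → a ≢ b → neq a b ≡ 1ℤ
neq-≢ a b p with a Fin.≟ b
... | yes q = ⊥-elim (p q)
... | no _ = refl

-- Proper colourings of a path with m edges (m + 1 vertices) whose end colours are a and b.
walks : Series N → ℕ → Fin N → Fin N → Series N
walks φ zero a b v = eq a b * φ (bump a v)
walks {N} φ (suc m) a b v = ∑ (allFin N) (λ a′ → neq a a′ * walks φ m a′ b (bump a v))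

-- Peeling off the last vertex obeys the same rule as peeling off the first; reversal symmetry
-- `walks-sym` follows from this.
walks-append : ∀ (φ : Series N) m a b v →
  walks φ (suc m) a b v ≡ ∑ (allFin N) (λ b′ → neq b b′ * walks φ m a b′ (bump b v))
walks-append {N} φ zero a b v = begin
  ∑ (allFin N) (λ a′ → neq a a′ * (eq a′ b * φ (bump a′ (bump a v))))
    ≡⟨ ∑-cong (allFin N) (λ a′ → trans (*-left-comm (neq a a′) (eq a′ b) _)
         (cong (_* (neq a a′ * φ (bump a′ (bump a v)))) (eq-sym a′ b))) ⟩
  ∑ (allFin N) (λ a′ → eq b a′ * (neq a a′ * φ (bump a′ (bump a v)))) ≡⟨ ∑-eq b _ ⟩
  neq a b * φ (bump b (bump a v)) ≡⟨ cong₂ _*_ (neq-sym a b) (cong φ (bump-comm b a v)) ⟩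
  neq b a * φ (bump a (bump b v)) ≡⟨ ∑-eq a (λ b′ → neq b b′ * φ (bump a (bump b v))) ⟨
  ∑ (allFin N) (λ b′ → eq a b′ * (neq b b′ * φ (bump a (bump b v))))
    ≡⟨ ∑-cong (allFin N) (λ b′ → *-left-comm (eq a b′) (neq b b′) _) ⟩
  ∑ (allFin N) (λ b′ → neq b b′ * (eq a b′ * φ (bump a (bump b v)))) ∎
walks-append {N} φ (suc m) a b v = begin
  ∑ (allFin N) (λ a′ → neq a a′ * walks φ (suc m) a′ b (bump a v))
    ≡⟨ ∑-cong (allFin N) (λ a′ → cong (λ z → neq a a′ * z) (walks-append φ m a′ b (bump a v))) ⟩
  ∑ (allFin N) (λ a′ → neq a a′ * ∑ (allFin N) (λ b′ → neq b b′ * walks φ m a′ b′ (bump b (bump a v))))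
    ≡⟨ ∑-swap-* (allFin N) (allFin N) (neq a) (neq b) (λ a′ b′ → walks φ m a′ b′ (bump b (bump a v))) ⟩
  ∑ (allFin N) (λ b′ → neq b b′ * ∑ (allFin N) (λ a′ → neq a a′ * walks φ m a′ b′ (bump b (bump a v))))
    ≡⟨ cong (λ w → ∑ (allFin N) (λ b′ → neq b b′ * ∑ (allFin N) (λ a′ → neq a a′ * walks φ m a′ b′ w))) (bump-comm b a v) ⟩
  ∑ (allFin N) (λ b′ → neq b b′ * walks φ (suc m) a b′ (bump b v)) ∎

walks-sym : ∀ (φ : Series N) m a b v → walks φ m a b v ≡ walks φ m b a v
walks-sym φ zero a b v = trans (eq-guard a b (λ p → cong (λ c → φ (bump c v)) p))
  (cong (_* φ (bump b v)) (eq-sym a b))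
walks-sym {N} φ (suc m) a b v = trans
  (∑-cong (allFin N) (λ a′ → cong (λ z → neq a a′ * z) (walks-sym φ m a′ b (bump a v))))
  (sym (walks-append φ m b a v))

walksFrom : Series N → ℕ → Fin N → Series N
walksFrom {N} φ m a v = ∑ (allFin N) (λ b → walks φ m a b v)

allWalks : Series N → ℕ → Series N
allWalks {N} φ m v = ∑ (allFin N) (λ a → walksFrom φ m a v)

-- The second vertex may have any colour except a: drop the restriction, then subtract the case in
-- which it is a.
walks-suc : ∀ (φ : Series N) m a b v →
  walks φ (suc m) a b v ≡ walksFrom φ m b (bump a v) - walks φ m a b (bump a v)
walks-suc {N} φ m a b v = trans (∑-neq a (λ a′ → walks φ m a′ b (bump a v)))
  (cong (λ z → z - walks φ m a b (bump a v)) (∑-cong (allFin N) (λ a′ → walks-sym φ m a′ b (bump a v))))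

walksFrom-neq : ∀ (φ : Series N) m a v →
  walksFrom φ (suc m) a v ≡ ∑ (allFin N) (λ a′ → neq a a′ * walksFrom φ m a′ (bump a v))
walksFrom-neq {N} φ m a v = trans (∑-swap (allFin N) (allFin N) _)
  (∑-cong (allFin N) (λ a′ → ∑-*ˡ (allFin N) (neq a a′) _))

walksFrom-suc : ∀ (φ : Series N) m a v →
  walksFrom φ (suc m) a v ≡ allWalks φ m (bump a v) - walksFrom φ m a (bump a v)
walksFrom-suc φ m a v = trans (walksFrom-neq φ m a v) (∑-neq a (λ a′ → walksFrom φ m a′ (bump a v)))

-- Both end vertices are peeled off, with inclusion-exclusion over the inner path starting in c or
-- ending in d. It is applied to distinct colours and on the diagonal.
walks-suc² : ∀ (φ : Series N) m c d v → let γ = bump d (bump c v) in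
  walks φ (suc (suc m)) c d v ≡
  allWalks φ m γ - walksFrom φ m c γ - walksFrom φ m d γ + walks φ m c d γ
walks-suc² φ m c d v = begin
  walks φ (suc (suc m)) c d v ≡⟨ walks-suc φ (suc m) c d v ⟩
  walksFrom φ (suc m) d v′ - walks φ (suc m) c d v′
    ≡⟨ cong₂ _-_ (walksFrom-suc φ m d v′) (trans (walks-sym φ (suc m) c d v′)
         (trans (walks-suc φ m d c v′) (cong (λ z → walksFrom φ m c γ - z) (walks-sym φ m d c γ)))) ⟩
  (allWalks φ m γ - walksFrom φ m d γ) - (walksFrom φ m c γ - walks φ m c d γ)
    ≡⟨ lem (allWalks φ m γ) (walksFrom φ m c γ) (walksFrom φ m d γ) (walks φ m c d γ) ⟩
  allWalks φ m γ - walksFrom φ m c γ - walksFrom φ m d γ + walks φ m c d γ ∎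
  where
  v′ = bump c v
  γ = bump d v′
  lem : ∀ t r s x → (t - s) - (r - x) ≡ t - r - s + x
  lem = solve-∀

-- Path and cycle colourings as sums over colour sets

mem-empty : ∀ (c : Fin N) S → card S ≡ 0 → mem c S ≡ 0ℤ
mem-empty zero (false ∷ S) p = refl
mem-empty (suc c) (false ∷ S) p = mem-empty c S p

mem-τ₀ : ∀ (F : ℕ → Series N) (c : Fin N) S v → mem c S * τ F 0 (card S) v ≡ 0ℤ
mem-τ₀ F c S v with card S in p
... | zero = cong (_* F 0 v) (mem-empty c S p)
... | suc k = ℤₚ.*-zeroʳ (mem c S)

containing : (ℕ → Series N) → ℕ → Fin N → Series N
containing {N} F n c v = ∑ (subsets N) (λ S → mem c S * τ F n (card S) (v ⊕ S))

containing₂ : (ℕ → Series N) → ℕ → Fin N → Fin N → Series N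
containing₂ {N} F n c d v = ∑ (subsets N) (λ S → mem c S * (mem d S * τ F n (card S) (v ⊕ S)))

∑-nmem : ∀ (c : Fin N) (f : Vec Bool N → ℤ) →
  ∑ (subsets N) (λ S → nmem c S * f S) ≡ ∑ (subsets N) f - ∑ (subsets N) (λ S → mem c S * f S)
∑-nmem {N} c f = trans (∑-cong (subsets N) (λ S → lem (mem c S) (f S))) (∑-− (subsets N) _ _)
  where
  lem : ∀ x y → (1ℤ - x) * y ≡ y - x * y
  lem = solve-∀

-- Deleting c leaves the sets that miss c, that is, all sets minus those containing c. This mirrors
-- `walksFrom-suc`, with the unweighted sum in place of `allWalks`.
containing-suc : ∀ (F : ℕ → Series N) n c v →
  containing F (suc n) c v ≡ GS F n (λ _ → 1ℤ) (bump c v) - containing F n c (bump c v)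
containing-suc {N} F n c v = begin
  containing F (suc n) c v
    ≡⟨ ∑-cong (subsets N) (λ S → cong (λ z → mem c S * z) (sym (ℤₚ.*-identityˡ (τ F (suc n) (card S) (v ⊕ S))))) ⟩
  ∑ (subsets N) (λ S → mem c S * (1ℤ * τ F (suc n) (card S) (v ⊕ S)))
    ≡⟨ ∑-remove c (λ _ → 1ℤ) (λ _ → refl) (τ F (suc n)) v ⟩
  ∑ (subsets N) (λ S → nmem c S * (1ℤ * τ F n (card S) (bump c v ⊕ S))) ≡⟨ ∑-nmem c _ ⟩
  GS F n (λ _ → 1ℤ) (bump c v) - ∑ (subsets N) (λ S → mem c S * (1ℤ * τ F n (card S) (bump c v ⊕ S)))
    ≡⟨ cong (λ z → GS F n (λ _ → 1ℤ) (bump c v) - z)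
         (∑-cong (subsets N) (λ S → cong (λ z → mem c S * z) (ℤₚ.*-identityˡ (τ F n (card S) (bump c v ⊕ S))))) ⟩
  GS F n (λ _ → 1ℤ) (bump c v) - containing F n c (bump c v) ∎

-- Deleting c does not affect whether d ≠ c belongs to S, so the condition on d survives; compare
-- `walks-suc`.
containing₂-suc : ∀ (F : ℕ → Series N) n {c d} → c ≢ d → ∀ v →
  containing₂ F (suc n) c d v ≡ containing F n d (bump c v) - containing₂ F n c d (bump c v)
containing₂-suc F n {c} {d} c≢d v = trans
  (∑-remove c (mem d) (mem-insert c d c≢d) (τ F (suc n)) v) (∑-nmem c _)

∑-containing : ∀ (F : ℕ → Series N) n v → ∑ (allFin N) (λ c → containing F n c v) ≡ GS F n path v
∑-containing {N} F n v = trans (∑-swap (allFin N) (subsets N) _)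
  (∑-cong (subsets N) (λ S → trans (∑-*ʳ (allFin N) (τ F n (card S) (v ⊕ S)) (λ c → mem c S))
    (cong (_* τ F n (card S) (v ⊕ S)) (card-mem S))))

-- Double counting: a set of k colours has k(k - 1) ordered pairs of distinct elements.
∑-containing₂ : ∀ (F : ℕ → Series N) n v →
  ∑ (allFin N) (λ c → ∑ (allFin N) (λ d → neq c d * containing₂ F n c d v)) ≡ GS F n cycle v
∑-containing₂ {N} F n v = begin
  ∑ (allFin N) (λ c → ∑ (allFin N) (λ d → neq c d * containing₂ F n c d v))
    ≡⟨ ∑-cong (allFin N) (λ c → trans
         (∑-cong (allFin N) (λ d → sym (∑-*ˡ (subsets N) (neq c d) _)))
         (∑-swap (allFin N) (subsets N) _)) ⟩
  ∑ (allFin N) (λ c → ∑ (subsets N) (λ S → ∑ (allFin N) (λ d → neq c d * (mem c S * (mem d S * t S)))))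
    ≡⟨ ∑-swap (allFin N) (subsets N) _ ⟩
  ∑ (subsets N) (λ S → ∑ (allFin N) (λ c → ∑ (allFin N) (λ d → neq c d * (mem c S * (mem d S * t S)))))
    ≡⟨ ∑-cong (subsets N) count ⟩
  GS F n cycle v ∎
  where
  t : Vec Bool N → ℤ
  t S = τ F n (card S) (v ⊕ S)
  idem : ∀ b → 𝟙 b * (𝟙 b * 1ℤ) ≡ 𝟙 b
  idem true = refl
  idem false = refl
  count : ∀ S → ∑ (allFin N) (λ c → ∑ (allFin N) (λ d → neq c d * (mem c S * (mem d S * t S)))) ≡ cycle (card S) * t S
  count S = begin
    ∑ (allFin N) (λ c → ∑ (allFin N) (λ d → neq c d * (mem c S * (mem d S * t S))))
      ≡⟨ ∑-cong (allFin N) (λ c → ∑-neq c (λ d → mem c S * (mem d S * t S))) ⟩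
    ∑ (allFin N) (λ c → ∑ (allFin N) (λ d → mem c S * (mem d S * t S)) - mem c S * (mem c S * t S))
      ≡⟨ ∑-cong (allFin N) (λ c → cong₂ _-_
           (trans (∑-*ˡ (allFin N) (mem c S) _) (cong (λ z → mem c S * z)
             (trans (∑-*ʳ (allFin N) (t S) (λ d → mem d S)) (cong (_* t S) (card-mem S)))))
           (trans (sym (ℤₚ.*-assoc (mem c S) (mem c S) (t S)))
             (cong (_* t S) (trans (cong (λ z → mem c S * z) (sym (ℤₚ.*-identityʳ (mem c S)))) (idem (lookup S c)))))) ⟩
    ∑ (allFin N) (λ c → mem c S * (+ card S * t S) - mem c S * t S)
      ≡⟨ ∑-− (allFin N) _ _ ⟩
    ∑ (allFin N) (λ c → mem c S * (+ card S * t S)) - ∑ (allFin N) (λ c → mem c S * t S)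
      ≡⟨ cong₂ _-_ (∑-*ʳ (allFin N) (+ card S * t S) (λ c → mem c S)) (∑-*ʳ (allFin N) (t S) (λ c → mem c S)) ⟩
    ∑ (allFin N) (λ c → mem c S) * (+ card S * t S) - ∑ (allFin N) (λ c → mem c S) * t S
      ≡⟨ cong (λ s → s * (+ card S * t S) - s * t S) (card-mem S) ⟩
    + card S * (+ card S * t S) - + card S * t S ≡⟨ lem₃ (+ card S) (t S) ⟩
    cycle (card S) * t S ∎
    where
    lem₃ : ∀ s t → s * (s * t) - s * t ≡ s * (s - 1ℤ) * t
    lem₃ = solve-∀

-- The weights satisfy k + [k = 0] = 1 + (k ∸ 1). The two extra sums agree: the first is the term of
-- the empty set, T_{n+1}, and the second is T_{n+1} by its recursion.
GS-path : ∀ (φ : Series N) n v → GS (P φ) (suc n) path v ≡ GS (P φ) (suc n) (λ _ → 1ℤ) v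
GS-path φ n v = begin
  GS (P φ) (suc n) path v ≡⟨ lem₁ _ (P φ (suc n) v) ⟩
  GS (P φ) (suc n) path v + P φ (suc n) v - P φ (suc n) v
    ≡⟨ cong (λ z → GS (P φ) (suc n) path v + z - P φ (suc n) v) (sym at-∅) ⟩
  GS (P φ) (suc n) path v + GS (P φ) (suc n) [0] v - P φ (suc n) v
    ≡⟨ cong (λ z → z - P φ (suc n) v) (trans (sym (GS-+ (P φ) (suc n) path [0] v))
         (trans (GS-weight (P φ) (suc n) weights v) (GS-+ (P φ) (suc n) (λ _ → 1ℤ) pred v))) ⟩
  GS (P φ) (suc n) (λ _ → 1ℤ) v + GS (P φ) (suc n) pred v - P φ (suc n) v
    ≡⟨ cong (λ z → GS (P φ) (suc n) (λ _ → 1ℤ) v + z - P φ (suc n) v) (sym (P-suc φ n v)) ⟩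
  GS (P φ) (suc n) (λ _ → 1ℤ) v + P φ (suc n) v - P φ (suc n) v ≡⟨ lem₁ _ (P φ (suc n) v) ⟨
  GS (P φ) (suc n) (λ _ → 1ℤ) v ∎
  where
  [0] : ℕ → ℤ
  [0] s = 𝟙 (s ≡ᵇ 0)
  lem₁ : ∀ x y → x ≡ x + y - y
  lem₁ = solve-∀
  at-∅ : GS (P φ) (suc n) [0] v ≡ P φ (suc n) v
  at-∅ = ∑-empty (τ (P φ) (suc n)) v
  weights : ∀ s → path s + [0] s ≡ 1ℤ + pred s
  weights zero = refl
  weights (suc s) = lem (+ s)
    where
    lem : ∀ x → (1ℤ + x) + 0ℤ ≡ 1ℤ + x
    lem = solve-∀

-- Both sides obey the same complement recursion once `GS-path` trades the weight |S|, which comes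
-- from summing over the start colour, for the weight 1.
walksFrom-S : ∀ (φ : Series N) m c v → walksFrom φ m c v ≡ containing (P φ) (suc m) c v
walksFrom-S {N} φ zero c v = begin
  walksFrom φ zero c v ≡⟨ ∑-eq c (λ _ → φ (bump c v)) ⟩
  φ (bump c v) ≡⟨ P-zero φ (bump c v) ⟨
  P φ 0 (bump c v) ≡⟨ at-∅ ⟨
  GS (P φ) 0 (λ _ → 1ℤ) (bump c v) ≡⟨ ℤₚ.+-identityʳ _ ⟨
  GS (P φ) 0 (λ _ → 1ℤ) (bump c v) - 0ℤ
    ≡⟨ cong (λ z → GS (P φ) 0 (λ _ → 1ℤ) (bump c v) - z)
         (sym (trans (∑-cong (subsets N) (λ S → mem-τ₀ (P φ) c S (bump c v ⊕ S))) (∑-zero (subsets N)))) ⟩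
  GS (P φ) 0 (λ _ → 1ℤ) (bump c v) - containing (P φ) 0 c (bump c v) ≡⟨ containing-suc (P φ) 0 c v ⟨
  containing (P φ) 1 c v ∎
  where
  at-∅ : GS (P φ) 0 (λ _ → 1ℤ) (bump c v) ≡ P φ 0 (bump c v)
  at-∅ = trans (GS-τ (P φ) 0 (λ _ → 1ℤ) (P φ) 0 (λ s → 𝟙 (s ≡ᵇ 0))
    (λ { zero w → refl ; (suc k) w → refl }) (bump c v)) (∑-empty (τ (P φ) 0) (bump c v))
walksFrom-S {N} φ (suc m) c v = begin
  walksFrom φ (suc m) c v ≡⟨ walksFrom-suc φ m c v ⟩
  allWalks φ m v′ - walksFrom φ m c v′
    ≡⟨ cong₂ _-_ (∑-cong (allFin N) (λ a → walksFrom-S φ m a v′)) (walksFrom-S φ m c v′) ⟩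
  ∑ (allFin N) (λ a → containing (P φ) (suc m) a v′) - containing (P φ) (suc m) c v′
    ≡⟨ cong (λ z → z - containing (P φ) (suc m) c v′) (trans (∑-containing (P φ) (suc m) v′) (GS-path φ m v′)) ⟩
  GS (P φ) (suc m) (λ _ → 1ℤ) v′ - containing (P φ) (suc m) c v′ ≡⟨ containing-suc (P φ) (suc m) c v ⟨
  containing (P φ) (suc (suc m)) c v ∎
  where v′ = bump c v

walks-S : ∀ (φ : Series N) m {c d} → c ≢ d → ∀ v → walks φ m c d v ≡ containing₂ (P φ) (suc m) c d v
walks-S {N} φ zero {c} {d} c≢d v = begin
  eq c d * φ (bump c v) ≡⟨ cong (_* φ (bump c v)) eq≡0 ⟩
  -- One vertex cannot have two colours. On the right, degree 0 leaves only the empty set, which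
  -- contains neither.
  0ℤ - 0ℤ ≡⟨ cong₂ _-_
    (trans (∑-cong (subsets N) (λ S → mem-τ₀ (P φ) d S (bump c v ⊕ S))) (∑-zero (subsets N)))
    (trans (∑-cong (subsets N) (λ S → trans (cong (λ z → mem c S * z) (mem-τ₀ (P φ) d S (bump c v ⊕ S))) (ℤₚ.*-zeroʳ (mem c S))))
      (∑-zero (subsets N))) ⟨
  containing (P φ) 0 d (bump c v) - containing₂ (P φ) 0 c d (bump c v) ≡⟨ containing₂-suc (P φ) 0 c≢d v ⟨
  containing₂ (P φ) 1 c d v ∎
  where
  eq≡0 : eq c d ≡ 0ℤ
  eq≡0 with c Fin.≟ d
  ... | yes p = ⊥-elim (c≢d p)
  ... | no _ = refl
walks-S φ (suc m) {c} {d} c≢d v = begin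
  walks φ (suc m) c d v ≡⟨ walks-suc φ m c d v ⟩
  walksFrom φ m d (bump c v) - walks φ m c d (bump c v)
    ≡⟨ cong₂ _-_ (walksFrom-S φ m d (bump c v)) (walks-S φ m c≢d (bump c v)) ⟩
  containing (P φ) (suc m) d (bump c v) - containing₂ (P φ) (suc m) c d (bump c v) ≡⟨ containing₂-suc (P φ) (suc m) c≢d v ⟨
  containing₂ (P φ) (suc (suc m)) c d v ∎

-- Ordered pairs of distinct colours

pairs : (Fin N → Fin N → ℤ) → ℤ
pairs {N} f = ∑ (allFin N) (λ c → ∑ (allFin N) (λ d → neq c d * f c d))

pairs-cong : ∀ {f g : Fin N → Fin N → ℤ} → (∀ c d → c ≢ d → f c d ≡ g c d) → pairs f ≡ pairs g
pairs-cong {N} h = ∑-cong (allFin N) (λ c → ∑-cong (allFin N) (λ d → neq-guard c d (h c d)))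

pairs-+ : ∀ (f g : Fin N → Fin N → ℤ) → pairs (λ c d → f c d + g c d) ≡ pairs f + pairs g
pairs-+ {N} f g = trans (∑-cong (allFin N) (λ c → trans
  (∑-cong (allFin N) (λ d → ℤₚ.*-distribˡ-+ (neq c d) (f c d) (g c d))) (∑-+ (allFin N) _ _)))
  (∑-+ (allFin N) _ _)

pairs-* : ∀ k (f : Fin N → Fin N → ℤ) → pairs (λ c d → k * f c d) ≡ k * pairs f
pairs-* {N} k f = trans (∑-cong (allFin N) (λ c → trans
  (∑-cong (allFin N) (λ d → *-left-comm (neq c d) k (f c d))) (∑-*ˡ (allFin N) k _)))
  (∑-*ˡ (allFin N) k _)

pairs-flip : ∀ (f : Fin N → Fin N → ℤ) → pairs f ≡ pairs (λ c d → f d c)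
pairs-flip {N} f = trans (∑-swap (allFin N) (allFin N) _)
  (∑-cong (allFin N) (λ c → ∑-cong (allFin N) (λ d → cong (_* f d c) (neq-sym d c))))

pairs-diagonal : ∀ (f : Fin N → Fin N → ℤ) →
  ∑ (allFin N) (λ c → ∑ (allFin N) (f c)) ≡ pairs f + ∑ (allFin N) (λ c → f c c)
pairs-diagonal {N} f = trans (∑-cong (allFin N) (λ c → trans (lem (∑ (allFin N) (f c)) (f c c))
    (cong (λ z → z + f c c) (sym (∑-neq c (f c))))))
  (∑-+ (allFin N) _ _)
  where
  lem : ∀ x y → x ≡ x - y + y
  lem = solve-∀

allWalks-S : ∀ (φ : Series N) m v → allWalks φ m v ≡ GS (P φ) (suc m) path v
allWalks-S {N} φ m v = trans (∑-cong (allFin N) (λ c → walksFrom-S φ m c v)) (∑-containing (P φ) (suc m) v)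

-- A cycle on m + 1 vertices cut at one edge: a path whose end colours must differ.
closedWalks : Series N → ℕ → Series N
closedWalks φ m v = pairs (λ c d → walks φ m c d v)

closedWalks-S : ∀ (φ : Series N) m v → closedWalks φ m v ≡ GS (P φ) (suc m) cycle v
closedWalks-S φ m v = trans (pairs-cong (λ c d p → walks-S φ m p v)) (∑-containing₂ (P φ) (suc m) v)

-- Read off from the path formula for a single vertex.
e-1 : ∀ (F : Series N) v → e 1 F v ≡ ∑ (allFin N) (λ c → F (bump c v))
e-1 {N} F v = begin
  e 1 F v ≡⟨ ∑-cong (subsets N) (λ S → pointwise (card S) (v ⊕ S)) ⟩
  GS (P F) 1 path v ≡⟨ allWalks-S F 0 v ⟨
  allWalks F 0 v ≡⟨ ∑-cong (allFin N) (λ c → ∑-eq c (λ _ → F (bump c v))) ⟩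
  ∑ (allFin N) (λ c → F (bump c v)) ∎
  where
  pointwise : ∀ k w → 𝟙 (k ≡ᵇ 1) * F w ≡ + k * τ (P F) 1 k w
  pointwise 0 w = refl
  pointwise 1 w = cong (λ z → 1ℤ * z) (sym (P-zero F w))
  pointwise (suc (suc k)) w = sym (ℤₚ.*-zeroʳ (+ suc (suc k)))

-- The path formula for two vertices: singletons carry T_1 = 0 and two-element sets carry the weight
-- 2.
e-2 : ∀ (F : Series N) v → + 2 * e 2 F v ≡ pairs (λ c d → F (bump d (bump c v)))
e-2 {N} F v = begin
  + 2 * e 2 F v ≡⟨ ∑-*ˡ (subsets N) (+ 2) _ ⟨
  ∑ (subsets N) (λ S → + 2 * (𝟙 (card S ≡ᵇ 2) * F (v ⊕ S)))
    ≡⟨ ∑-cong (subsets N) (λ S → pointwise (card S) (v ⊕ S)) ⟩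
  GS (P F) 2 path v ≡⟨ allWalks-S F 1 v ⟨
  allWalks F 1 v ≡⟨ ∑-cong (allFin N) (λ c → walksFrom-neq F 0 c v) ⟩
  ∑ (allFin N) (λ c → ∑ (allFin N) (λ d → neq c d * walksFrom F 0 d (bump c v)))
    ≡⟨ pairs-cong (λ c d _ → ∑-eq d (λ _ → F (bump d (bump c v)))) ⟩
  pairs (λ c d → F (bump d (bump c v))) ∎
  where
  P₁≡0 : ∀ w → P F 1 w ≡ 0ℤ
  P₁≡0 w = trans (P-suc F 0 w) (GS-zero (P F) 1 pred (λ where
    0 w → refl
    1 w → refl
    (suc (suc k)) w → ℤₚ.*-zeroʳ (pred (suc (suc k)))) w)
  pointwise : ∀ k w → + 2 * (𝟙 (k ≡ᵇ 2) * F w) ≡ + k * τ (P F) 2 k w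
  pointwise 0 w = refl
  pointwise 1 w = sym (cong (λ z → 1ℤ * z) (P₁≡0 w))
  pointwise 2 w = cong (λ z → + 2 * z) (trans (ℤₚ.*-identityˡ (F w)) (sym (P-zero F w)))
  pointwise (suc (suc (suc k))) w = sym (ℤₚ.*-zeroʳ (+ suc (suc (suc k))))

-- Inclusion-exclusion for the twinned cycle

-- Without v and v' the graph is a path whose ends are the common neighbours of v and v', so both
-- ends avoid both colours.
avoiding : Series N → ℕ → Fin N → Fin N → Series N
avoiding {N} φ m c d v = ∑ (allFin N) (λ a → neq c a * (neq d a *
  ∑ (allFin N) (λ b → neq c b * (neq d b * walks φ m a b v))))

∑-neq₂ : ∀ {c d : Fin N} → c ≢ d → (f : Fin N → ℤ) →
  ∑ (allFin N) (λ a → neq c a * (neq d a * f a)) ≡ ∑ (allFin N) f - f d - f c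
∑-neq₂ {N} {c} {d} c≢d f = trans (∑-neq c (λ a → neq d a * f a))
  (cong₂ _-_ (∑-neq d f) (trans (cong (_* f c) (neq-≢ d c (c≢d ∘ sym))) (ℤₚ.*-identityˡ (f c))))

-- Two excluded colours at each end give nine terms, which reversal symmetry merges into six.
avoiding-expand : ∀ (φ : Series N) m {c d} → c ≢ d → ∀ v →
  avoiding φ m c d v ≡ allWalks φ m v + (- + 2 * walksFrom φ m c v + (- + 2 * walksFrom φ m d v
    + (walks φ m c c v + (walks φ m d d v + + 2 * walks φ m c d v))))
avoiding-expand {N} φ m {c} {d} c≢d v = begin
  avoiding φ m c d v
    ≡⟨ ∑-cong (allFin N) (λ a → cong (λ z → neq c a * (neq d a * z)) (∑-neq₂ c≢d (λ b → walks φ m a b v))) ⟩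
  ∑ (allFin N) (λ a → neq c a * (neq d a * f a)) ≡⟨ ∑-neq₂ c≢d f ⟩
  ∑ (allFin N) f - f d - f c
    ≡⟨ cong (λ z → z - f d - f c) (trans (∑-− (allFin N) _ _) (cong₂ _-_ (∑-− (allFin N) _ _) (column c))) ⟩
  allWalks φ m v - ∑ (allFin N) (λ a → walks φ m a d v) - walksFrom φ m c v - f d - f c
    ≡⟨ cong₂ (λ x y → allWalks φ m v - x - walksFrom φ m c v - (walksFrom φ m d v - walks φ m d d v - y) - f c)
         (column d) (walks-sym φ m d c v) ⟩
  allWalks φ m v - walksFrom φ m d v - walksFrom φ m c v
    - (walksFrom φ m d v - walks φ m d d v - walks φ m c d v) - f c
    ≡⟨ lem (allWalks φ m v) (walksFrom φ m c v) (walksFrom φ m d v) (walks φ m c c v) (walks φ m d d v) (walks φ m c d v) ⟩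
  _ ∎
  where
  f : Fin N → ℤ
  f a = walksFrom φ m a v - walks φ m a d v - walks φ m a c v
  column : ∀ b → ∑ (allFin N) (λ a → walks φ m a b v) ≡ walksFrom φ m b v
  column b = ∑-cong (allFin N) (λ a → walks-sym φ m a b v)
  lem : ∀ t r s x y z → t - s - r - (s - y - z) - (r - z - x) ≡
    t + (- + 2 * r + (- + 2 * s + (x + (y + + 2 * z))))
  lem = solve-∀

-- The twinned cycle is built from a path on m + 1 vertices and two further adjacent vertices coloured c and d.
twin : Series N → ℕ → Series N
twin φ m v = pairs (λ c d → avoiding φ m c d (bump d (bump c v)))

-- Every series here is a combination of `t`, `r`, `x`, `z`: the path on n - 1 vertices is free,
-- starts with d, starts and ends with d, or runs from c to d. The twin is t - 4r + 2x + 2z, C_{n+1}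
-- is t - 2r + z, P_{n+1} is t - r, and 2e_2 X_{P_{n-1}} is t. The product e_1 X_{C_n} = t - r + x -
-- z is the one that supplies `x`.
twin-expand : ∀ (φ : Series N) m v →
  twin φ m v ≡ + 2 * e 1 (closedWalks φ (suc m)) v + + 4 * closedWalks φ (suc (suc m)) v
    + + 2 * e 2 (allWalks φ m) v - + 6 * allWalks φ (suc (suc m)) v
twin-expand {N} φ m v = begin
  twin φ m v ≡⟨ twin≡ ⟩
  t + (- + 2 * r + (- + 2 * r + (x + (x + + 2 * z)))) ≡⟨ lem t r x z ⟩
  + 2 * ((t - + 2 * r + x) + ((t - r) - (t - r - r + z))) + + 4 * (t - r - r + z) + t - + 6 * (t - r)
    ≡⟨ cong₂ (λ a b → + 2 * a + + 4 * b + t - + 6 * (t - r)) e₁≡ closed≡ ⟨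
  + 2 * e 1 (closedWalks φ (suc m)) v + + 4 * closedWalks φ (suc (suc m)) v + t - + 6 * (t - r)
    ≡⟨ cong₂ (λ a b → + 2 * e 1 (closedWalks φ (suc m)) v + + 4 * closedWalks φ (suc (suc m)) v + a - + 6 * b)
         (e-2 (allWalks φ m) v) all≡ ⟨
  _ ∎
  where
  γ : Fin N → Fin N → Vec ℕ N
  γ c d = bump d (bump c v)
  t = pairs (λ c d → allWalks φ m (γ c d))
  r = pairs (λ c d → walksFrom φ m d (γ c d))
  x = pairs (λ c d → walks φ m d d (γ c d))
  z = pairs (λ c d → walks φ m c d (γ c d))
  flipped : (f : Fin N → Series N) → pairs (λ c d → f c (γ c d)) ≡ pairs (λ c d → f d (γ c d))
  flipped f = trans (pairs-flip _) (pairs-cong (λ c d _ → cong (f d) (bump-comm c d v)))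
  r≡ : pairs (λ c d → walksFrom φ m c (γ c d)) ≡ r
  r≡ = flipped (walksFrom φ m)
  lem : ∀ t r x z → t + (- + 2 * r + (- + 2 * r + (x + (x + + 2 * z)))) ≡
    + 2 * ((t - + 2 * r + x) + ((t - r) - (t - r - r + z))) + + 4 * (t - r - r + z) + t - + 6 * (t - r)
  lem = solve-∀
  pairs-− : ∀ (f g : Fin N → Fin N → ℤ) → pairs (λ c d → f c d - g c d) ≡ pairs f - pairs g
  pairs-− f g = trans (pairs-cong (λ c d _ → minus (f c d) (g c d))) (trans (pairs-+ f (λ c d → - 1ℤ * g c d))
    (trans (cong (λ z → pairs f + z) (pairs-* (- 1ℤ) g)) (sym (minus (pairs f) (pairs g)))))
    where
    minus : ∀ x y → x - y ≡ x + - 1ℤ * y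
    minus = solve-∀
  twin≡ : twin φ m v ≡ t + (- + 2 * r + (- + 2 * r + (x + (x + + 2 * z))))
  twin≡ = begin
    twin φ m v ≡⟨ pairs-cong (λ c d p → avoiding-expand φ m p (γ c d)) ⟩
    pairs (λ c d → allWalks φ m (γ c d) + (- + 2 * walksFrom φ m c (γ c d) + (- + 2 * walksFrom φ m d (γ c d)
      + (walks φ m c c (γ c d) + (walks φ m d d (γ c d) + + 2 * walks φ m c d (γ c d))))))
      ≡⟨ trans (pairs-+ _ _) (cong (λ y → t + y) (trans (pairs-+ _ _) (cong₂ _+_ (pairs-* (- + 2) _)
           (trans (pairs-+ _ _) (cong₂ _+_ (pairs-* (- + 2) _)
           (trans (pairs-+ _ _) (cong₂ _+_ (flipped (λ c → walks φ m c c))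
           (trans (pairs-+ _ _) (cong (λ y → x + y) (pairs-* (+ 2) _)))))))))) ⟩
    t + (- + 2 * pairs (λ c d → walksFrom φ m c (γ c d)) + (- + 2 * r + (x + (x + + 2 * z))))
      ≡⟨ cong (λ y → t + (- + 2 * y + (- + 2 * r + (x + (x + + 2 * z))))) r≡ ⟩
    t + (- + 2 * r + (- + 2 * r + (x + (x + + 2 * z)))) ∎
  closed≡ : closedWalks φ (suc (suc m)) v ≡ t - r - r + z
  closed≡ = trans (pairs-cong (λ c d _ → walks-suc² φ m c d v))
    (trans (pairs-+ _ _) (cong (λ y → y + z) (trans (pairs-− _ _) (cong (λ y → y - r)
      (trans (pairs-− _ _) (cong (λ y → t - y) r≡))))))
  all≡ : allWalks φ (suc (suc m)) v ≡ t - r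
  all≡ = trans (∑-cong (allFin N) (λ c → walksFrom-neq φ (suc m) c v))
    (trans (pairs-cong (λ c d _ → walksFrom-suc φ m d (bump c v))) (pairs-− _ _))
  -- The path colourings with both ends different from d; a vertex of colour d closes each of them
  -- to a cycle.
  g : Fin N → Series N
  g d w = allWalks φ m w - + 2 * walksFrom φ m d w + walks φ m d d w
  closing : ∀ w → closedWalks φ (suc m) w ≡ ∑ (allFin N) (λ d → g d (bump d w))
  closing w = ∑-cong (allFin N) (λ d → trans (∑-neq d (λ b → walks φ (suc m) d b w))
    (trans (cong₂ _-_ (walksFrom-suc φ m d w) (walks-suc φ m d d w))
      (rearrange (allWalks φ m (bump d w)) (walksFrom φ m d (bump d w)) (walks φ m d d (bump d w)))))
    where
    rearrange : ∀ t r x → t - r - (r - x) ≡ t - + 2 * r + x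
    rearrange = solve-∀
  -- When the factor e_1 repeats the colour c of the closing vertex, the two copies can be put at
  -- the two ends of the path. These are the colourings of P_{n+1} with equal end colours, i.e. all
  -- of them minus those of C_{n+1}.
  diagonal : ∑ (allFin N) (λ c → g c (γ c c)) ≡ (t - r) - (t - r - r + z)
  diagonal = begin
    ∑ (allFin N) (λ c → g c (γ c c))
      ≡⟨ ∑-cong (allFin N) (λ c → trans
           (rearrange (allWalks φ m (γ c c)) (walksFrom φ m c (γ c c)) (walks φ m c c (γ c c)))
           (trans (sym (walks-suc² φ m c c v)) (complement c))) ⟩
    ∑ (allFin N) (λ c → walksFrom φ (suc (suc m)) c v - ∑ (allFin N) (λ d → neq c d * walks φ (suc (suc m)) c d v))
      ≡⟨ ∑-− (allFin N) _ _ ⟩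
    allWalks φ (suc (suc m)) v - closedWalks φ (suc (suc m)) v ≡⟨ cong₂ _-_ all≡ closed≡ ⟩
    (t - r) - (t - r - r + z) ∎
    where
    rearrange : ∀ t r x → t - + 2 * r + x ≡ t - r - r + x
    rearrange = solve-∀
    cancel : ∀ x y → y ≡ x - (x - y)
    cancel = solve-∀
    complement : ∀ c → walks φ (suc (suc m)) c c v ≡
      walksFrom φ (suc (suc m)) c v - ∑ (allFin N) (λ d → neq c d * walks φ (suc (suc m)) c d v)
    complement c = trans (cancel (walksFrom φ (suc (suc m)) c v) (walks φ (suc (suc m)) c c v))
      (cong (λ z → walksFrom φ (suc (suc m)) c v - z) (sym (∑-neq c (λ d → walks φ (suc (suc m)) c d v))))
  e₁≡ : e 1 (closedWalks φ (suc m)) v ≡ (t - + 2 * r + x) + ((t - r) - (t - r - r + z))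
  e₁≡ = begin
    e 1 (closedWalks φ (suc m)) v ≡⟨ e-1 (closedWalks φ (suc m)) v ⟩
    ∑ (allFin N) (λ c → closedWalks φ (suc m) (bump c v)) ≡⟨ ∑-cong (allFin N) (λ c → closing (bump c v)) ⟩
    ∑ (allFin N) (λ c → ∑ (allFin N) (λ d → g d (γ c d))) ≡⟨ pairs-diagonal (λ c d → g d (γ c d)) ⟩
    pairs (λ c d → g d (γ c d)) + ∑ (allFin N) (λ c → g c (γ c c))
      ≡⟨ cong₂ _+_ (trans (pairs-+ _ _) (cong (λ y → y + x)
           (trans (pairs-− _ _) (cong (λ y → t - y) (pairs-* (+ 2) _))))) diagonal ⟩
    (t - + 2 * r + x) + ((t - r) - (t - r - r + z)) ∎

twin-series : ∀ (φ : Series N) m v →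
  twin φ m v ≡ + 2 * e 1 (GS (P φ) (2 ℕ.+ m) cycle) v + + 4 * GS (P φ) (3 ℕ.+ m) cycle v
    + + 2 * e 2 (GS (P φ) (1 ℕ.+ m) path) v - + 6 * GS (P φ) (3 ℕ.+ m) path v
twin-series φ m v = trans (twin-expand φ m v)
  (cong₂ _-_ (cong₂ _+_ (cong₂ _+_
    (cong (λ z → + 2 * z) (e-cong 1 (closedWalks-S φ (suc m)) v))
    (cong (λ z → + 4 * z) (closedWalks-S φ (suc (suc m)) v)))
    (cong (λ z → + 2 * z) (e-cong 2 (allWalks-S φ m) v)))
    (cong (λ z → + 6 * z) (allWalks-S φ (suc (suc m)) v)))

-- Coefficients as values on an indicator

allᵇ-cong : ∀ {p q : A → Bool} → (∀ x → p x ≡ q x) → ∀ xs → allᵇ p xs ≡ allᵇ q xs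
allᵇ-cong h xs = cong and (map-cong h xs)

countᵇ-map : ∀ {B : Set} (p : B → Bool) (f : A → B) xs → countᵇ p (map f xs) ≡ countᵇ (p ∘ f) xs
countᵇ-map p f [] = refl
countᵇ-map p f (x ∷ xs) with p (f x)
... | true = cong suc (countᵇ-map p f xs)
... | false = countᵇ-map p f xs

bit : Bool → ℕ
bit true = 1
bit false = 0

countᵇ-∷ : ∀ (p : A → Bool) x xs → countᵇ p (x ∷ xs) ≡ bit (p x) ℕ.+ countᵇ p xs
countᵇ-∷ p x xs with p x
... | true = refl
... | false = refl

countᵇ-allFin : ∀ {k} (p : Fin (suc k) → Bool) →
  countᵇ p (allFin (suc k)) ≡ bit (p zero) ℕ.+ countᵇ (p ∘ suc) (allFin k)
countᵇ-allFin {k} p = trans (cong (countᵇ p) (allFin-suc k)) (trans (countᵇ-∷ p zero _)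
  (cong (bit (p zero) ℕ.+_) (countᵇ-map p suc (allFin k))))

-- The functional dual to x^α: a series tested against it at exponent zero yields its coefficient of
-- x^α.
indicator : (Fin N → ℕ) → Series N
indicator {N} α v = 𝟙 (allᵇ (λ c → lookup v c ≡ᵇ α c) (allFin N))

size-tabulate : ∀ (S : Subset N) → size S ≡ card (Vec.tabulate S)
size-tabulate {zero} S = refl
size-tabulate {suc N} S = trans (countᵇ-allFin S) (lem (S zero))
  where
  lem : ∀ b → bit b ℕ.+ size (S ∘ suc) ≡ card (b ∷ Vec.tabulate (S ∘ suc))
  lem true = cong suc (size-tabulate (S ∘ suc))
  lem false = size-tabulate (S ∘ suc)

∑-allSubsets : ∀ N (G : Vec Bool N → ℤ) → ∑ (allSubsets N) (G ∘ Vec.tabulate) ≡ ∑ (subsets N) G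
∑-allSubsets zero G = trans (∑-singleton _ (G ∘ Vec.tabulate)) (sym (∑-singleton [] G))
∑-allSubsets (suc N) G = trans (∑-allFuns (true ∷ false ∷ []) N (G ∘ Vec.tabulate))
  (trans (∑-cong (true ∷ false ∷ []) (λ b → trans (∑-allSubsets N (G ∘ (b ∷_))) (sym (∑-map (b ∷_) (subsets N) G))))
    (sym (∑-concatMap (λ b → map (b ∷_) (subsets N)) (true ∷ false ∷ []) G)))

addSubsets : Vec ℕ N → List (Subset N) → Vec ℕ N
addSubsets v [] = v
addSubsets v (S ∷ Ss) = addSubsets (v ⊕ Vec.tabulate S) Ss

∑-subsetTuples : ∀ (φ : Series N) I v → ∑ (subsetTuples N I) (φ ∘ addSubsets v) ≡ E φ I v
∑-subsetTuples φ [] v = ∑-singleton [] _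
∑-subsetTuples {N} φ (k ∷ I) v = begin
  ∑ (subsetTuples N (k ∷ I)) (φ ∘ addSubsets v)
    ≡⟨ ∑-concatMap (λ S → map (S ∷_) (subsetTuples N I)) (filterᵇ (λ S → size S ≡ᵇ k) (allSubsets N)) _ ⟩
  ∑ (filterᵇ (λ S → size S ≡ᵇ k) (allSubsets N)) (λ S → ∑ (map (S ∷_) (subsetTuples N I)) (φ ∘ addSubsets v))
    ≡⟨ ∑-filter (λ S → size S ≡ᵇ k) (allSubsets N) _ ⟩
  ∑ (allSubsets N) (λ S → 𝟙 (size S ≡ᵇ k) * ∑ (map (S ∷_) (subsetTuples N I)) (φ ∘ addSubsets v))
    ≡⟨ ∑-cong (allSubsets N) (λ S → cong₂ (λ s z → 𝟙 (s ≡ᵇ k) * z) (size-tabulate S)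
         (trans (∑-map (S ∷_) (subsetTuples N I) _) (∑-subsetTuples φ I (v ⊕ Vec.tabulate S)))) ⟩
  ∑ (allSubsets N) (λ S → 𝟙 (card (Vec.tabulate S) ≡ᵇ k) * E φ I (v ⊕ Vec.tabulate S))
    ≡⟨ ∑-allSubsets N (λ S → 𝟙 (card S ≡ᵇ k) * E φ I (v ⊕ S)) ⟩
  E φ (k ∷ I) v ∎

lookup-⊕ : ∀ (v : Vec ℕ N) S c → lookup (v ⊕ S) c ≡ bit (lookup S c) ℕ.+ lookup v c
lookup-⊕ (x ∷ v) (true ∷ S) zero = refl
lookup-⊕ (x ∷ v) (false ∷ S) zero = refl
lookup-⊕ (x ∷ v) (true ∷ S) (suc c) = lookup-⊕ v S c
lookup-⊕ (x ∷ v) (false ∷ S) (suc c) = lookup-⊕ v S c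

+-rotate : ∀ a b c → (a ℕ.+ b) ℕ.+ c ≡ b ℕ.+ (a ℕ.+ c)
+-rotate a b c = trans (cong (ℕ._+ c) (ℕₚ.+-comm a b)) (ℕₚ.+-assoc b a c)

lookup-addSubsets : ∀ (v : Vec ℕ N) Ss c →
  lookup (addSubsets v Ss) c ≡ lookup v c ℕ.+ countᵇ (λ S → S c) Ss
lookup-addSubsets v [] c = sym (ℕₚ.+-identityʳ _)
lookup-addSubsets v (S ∷ Ss) c = begin
  lookup (addSubsets (v ⊕ Vec.tabulate S) Ss) c ≡⟨ lookup-addSubsets (v ⊕ Vec.tabulate S) Ss c ⟩
  lookup (v ⊕ Vec.tabulate S) c ℕ.+ n
    ≡⟨ cong (ℕ._+ n) (trans (lookup-⊕ v (Vec.tabulate S) c) (cong (λ b → bit b ℕ.+ lookup v c) (lookup∘tabulate S c))) ⟩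
  bit (S c) ℕ.+ lookup v c ℕ.+ n ≡⟨ +-rotate (bit (S c)) (lookup v c) n ⟩
  lookup v c ℕ.+ (bit (S c) ℕ.+ n) ≡⟨ cong (lookup v c ℕ.+_) (countᵇ-∷ (λ S → S c) S Ss) ⟨
  lookup v c ℕ.+ countᵇ (λ S → S c) (S ∷ Ss) ∎
  where n = countᵇ (λ S → S c) Ss

𝟎 : Vec ℕ N
𝟎 {N} = replicate N 0

eCoeff-E : ∀ N I (α : Fin N → ℕ) → + eCoeff N I α ≡ E (indicator α) I 𝟎
eCoeff-E N I α = trans (∑-countᵇ _ (subsetTuples N I))
  (trans (∑-cong (subsetTuples N I) (λ Ss → cong 𝟙 (allᵇ-cong
    (λ c → cong (_≡ᵇ α c) (sym (trans (lookup-addSubsets 𝟎 Ss c)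
      (cong (ℕ._+ countᵇ (λ S → S c) Ss) (lookup-replicate c 0))))) (allFin N))))
    (∑-subsetTuples (indicator α) I 𝟎))

addColours : ∀ {k} → Vec ℕ N → (Fin k → Fin N) → Vec ℕ N
addColours {k = zero} v κ = v
addColours {k = suc k} v κ = addColours (bump (κ zero) v) (κ ∘ suc)

lookup-bump : ∀ (d : Fin N) v c → lookup (bump d v) c ≡ bit (d == c) ℕ.+ lookup v c
lookup-bump zero (x ∷ v) zero = refl
lookup-bump zero (x ∷ v) (suc c) = refl
lookup-bump (suc d) (x ∷ v) zero = refl
lookup-bump (suc d) (x ∷ v) (suc c) = trans (lookup-bump d v c) (cong (λ b → bit b ℕ.+ lookup v c) (sym (==-suc d c)))

lookup-addColours : ∀ {k} (v : Vec ℕ N) (κ : Fin k → Fin N) c →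
  lookup (addColours v κ) c ≡ lookup v c ℕ.+ countᵇ (λ i → κ i == c) (allFin k)
lookup-addColours {k = zero} v κ c = sym (ℕₚ.+-identityʳ _)
lookup-addColours {k = suc k} v κ c = begin
  lookup (addColours (bump (κ zero) v) (κ ∘ suc)) c ≡⟨ lookup-addColours (bump (κ zero) v) (κ ∘ suc) c ⟩
  lookup (bump (κ zero) v) c ℕ.+ n ≡⟨ cong (ℕ._+ n) (lookup-bump (κ zero) v c) ⟩
  bit (κ zero == c) ℕ.+ lookup v c ℕ.+ n ≡⟨ +-rotate (bit (κ zero == c)) (lookup v c) n ⟩
  lookup v c ℕ.+ (bit (κ zero == c) ℕ.+ n) ≡⟨ cong (lookup v c ℕ.+_) (countᵇ-allFin (λ i → κ i == c)) ⟨
  lookup v c ℕ.+ countᵇ (λ i → κ i == c) (allFin (suc k)) ∎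
  where n = countᵇ (λ i → κ (suc i) == c) (allFin k)

XCoeff-∑ : ∀ m adj N (α : Fin N → ℕ) →
  + XCoeff m adj N α ≡ ∑ (allFuns (allFin N) m) (λ κ → 𝟙 (proper adj κ) * indicator α (addColours 𝟎 κ))
XCoeff-∑ m adj N α = trans (∑-countᵇ _ (allFuns (allFin N) m))
  (∑-cong (allFuns (allFin N) m) (λ κ → trans (𝟙-∧ (proper adj κ) (hasContent κ α))
    (cong (λ b → 𝟙 (proper adj κ) * 𝟙 b) (allᵇ-cong
      (λ c → cong (_≡ᵇ α c) (sym (trans (lookup-addColours 𝟎 κ c)
        (cong (ℕ._+ countᵇ (λ i → κ i == c) (allFin m)) (lookup-replicate c 0))))) (allFin N)))))

-- The two enumerations of compositions

-- Compositions of r into l parts. The entry bound n stays fixed while r decreases, as in the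
-- brute-force enumeration.
listsSum : ℕ → ℕ → ℕ → (List ℕ → ℤ) → ℤ
listsSum n l r g = ∑ (listsOfLen l n) (λ I → 𝟙 (isCompositionᵇ r I) * g I)

∑-upTo-< : ∀ n k → k ≤ n → (f : ℕ → ℤ) → ∑ (upTo n) (λ a → 𝟙 (a <ᵇ k) * f a) ≡ ∑ (upTo k) f
∑-upTo-< zero zero p f = trans (∑-[] _) (sym (∑-[] f))
∑-upTo-< (suc n) zero p f = trans (∑-zero (upTo (suc n))) (sym (∑-[] f))
∑-upTo-< (suc n) (suc k) (s≤s p) f = trans (∑-upTo n _)
  (trans (cong₂ _+_ (ℤₚ.*-identityˡ (f 0)) (∑-upTo-< n k p (f ∘ suc))) (sym (∑-upTo k f)))

-- The guard excludes a > r, where the truncated difference would wrongly accept s = 0.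
≡ᵇ-split : ∀ a s r → (a ℕ.+ s ≡ᵇ r) ≡ (a <ᵇ suc r) ∧ (s ≡ᵇ r ∸ a)
≡ᵇ-split zero s r = refl
≡ᵇ-split (suc a) s zero = refl
≡ᵇ-split (suc a) s (suc r) = ≡ᵇ-split a s r

listsSum-suc : ∀ n l r g → listsSum n (suc l) (suc r) g ≡
  ∑ (upTo n) (λ a → 𝟙 (a <ᵇ suc r) * listsSum n l (r ∸ a) (λ I → g (suc a ∷ I)))
listsSum-suc n l r g = begin
  listsSum n (suc l) (suc r) g
    ≡⟨ trans (∑-concatMap (λ a → map (a ∷_) (listsOfLen l n)) (upTo (suc n)) _)
         (∑-cong (upTo (suc n)) (λ a → ∑-map (a ∷_) (listsOfLen l n) _)) ⟩
  ∑ (upTo (suc n)) (λ a → ∑ (listsOfLen l n) (λ I → 𝟙 (isCompositionᵇ (suc r) (a ∷ I)) * g (a ∷ I)))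
    ≡⟨ ∑-upTo n _ ⟩
  ∑ (listsOfLen l n) (λ I → 𝟙 ((sum I ≡ᵇ suc r) ∧ false) * g (0 ∷ I)) + ∑ (upTo n) tail
    ≡⟨ cong (λ z → z + ∑ (upTo n) tail) (trans (∑-cong (listsOfLen l n) (λ I → zeros (sum I ≡ᵇ suc r) (g (0 ∷ I)))) (∑-zero (listsOfLen l n))) ⟩
  0ℤ + ∑ (upTo n) tail ≡⟨ ℤₚ.+-identityˡ _ ⟩
  ∑ (upTo n) tail
    ≡⟨ ∑-cong (upTo n) (λ a → trans (∑-cong (listsOfLen l n) (λ I → split a I)) (∑-*ˡ (listsOfLen l n) (𝟙 (a <ᵇ suc r)) _)) ⟩
  ∑ (upTo n) (λ a → 𝟙 (a <ᵇ suc r) * listsSum n l (r ∸ a) (λ I → g (suc a ∷ I))) ∎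
  where
  tail : ℕ → ℤ
  tail a = ∑ (listsOfLen l n) (λ I → 𝟙 (isCompositionᵇ (suc r) (suc a ∷ I)) * g (suc a ∷ I))
  zeros : ∀ b x → 𝟙 (b ∧ false) * x ≡ 0ℤ
  zeros true x = refl
  zeros false x = refl
  split : ∀ a I → 𝟙 (isCompositionᵇ (suc r) (suc a ∷ I)) * g (suc a ∷ I) ≡
    𝟙 (a <ᵇ suc r) * (𝟙 (isCompositionᵇ (r ∸ a) I) * g (suc a ∷ I))
  split a I = trans (cong (λ b → 𝟙 (b ∧ pos) * g (suc a ∷ I)) (≡ᵇ-split a (sum I) r)) (assoc (a <ᵇ suc r))
    where
    pos = allᵇ (λ i → 1 ≤ᵇ i) I
    assoc : ∀ b → 𝟙 ((b ∧ (sum I ≡ᵇ r ∸ a)) ∧ pos) * g (suc a ∷ I) ≡ 𝟙 b * (𝟙 (isCompositionᵇ (r ∸ a) I) * g (suc a ∷ I))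
    assoc true = sym (ℤₚ.*-identityˡ (𝟙 (isCompositionᵇ (r ∸ a) I) * g (suc a ∷ I)))
    assoc false = refl

listsSum-zero : ∀ n l g → listsSum n (suc l) 0 g ≡ 0ℤ
listsSum-zero n l g = trans (∑-concatMap (λ a → map (a ∷_) (listsOfLen l n)) (upTo (suc n)) _)
  (trans (∑-cong (upTo (suc n)) (λ a → trans (∑-map (a ∷_) (listsOfLen l n) _)
    (trans (∑-cong (listsOfLen l n) (λ I → zeros a I)) (∑-zero (listsOfLen l n))))) (∑-zero (upTo (suc n))))
  where
  zeros : ∀ a I → 𝟙 (isCompositionᵇ 0 (a ∷ I)) * g (a ∷ I) ≡ 0ℤ
  zeros zero I with sum I ≡ᵇ 0
  ... | true = refl
  ... | false = refl
  zeros (suc a) I = refl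

-- The length bound L is the fuel of `comps`. A first part never exceeds the total, so the larger
-- range of entries contributes nothing more.
∑-listsSum : ∀ n L r g → r ≤ n → r ≤ L → ∑ (upTo (suc L)) (λ l → listsSum n l r g) ≡ ∑ (comps L r) g
∑-listsSum n L zero g _ _ = begin
  ∑ (upTo (suc L)) (λ l → listsSum n l 0 g) ≡⟨ ∑-upTo L _ ⟩
  listsSum n 0 0 g + ∑ (upTo L) (λ l → listsSum n (suc l) 0 g)
    ≡⟨ cong₂ _+_ (trans (∑-singleton [] _) (ℤₚ.*-identityˡ (g [])))
         (trans (∑-cong (upTo L) (λ l → listsSum-zero n l g)) (∑-zero (upTo L))) ⟩
  g [] + 0ℤ ≡⟨ ℤₚ.+-identityʳ _ ⟩
  g [] ≡⟨ ∑-singleton [] g ⟨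
  ∑ (comps L 0) g ∎
∑-listsSum n (suc L) (suc r) g p (s≤s q) = begin
  ∑ (upTo (suc (suc L))) (λ l → listsSum n l (suc r) g) ≡⟨ ∑-upTo (suc L) _ ⟩
  listsSum n 0 (suc r) g + ∑ (upTo (suc L)) (λ l → listsSum n (suc l) (suc r) g)
    ≡⟨ cong₂ _+_ (∑-singleton [] _)
         (∑-cong (upTo (suc L)) (λ l → listsSum-suc n l r g)) ⟩
  0ℤ + ∑ (upTo (suc L)) (λ l → ∑ (upTo n) (λ a → 𝟙 (a <ᵇ suc r) * listsSum n l (r ∸ a) (g ∘ (suc a ∷_))))
    ≡⟨ trans (ℤₚ.+-identityˡ _) (∑-swap (upTo (suc L)) (upTo n) _) ⟩
  ∑ (upTo n) (λ a → ∑ (upTo (suc L)) (λ l → 𝟙 (a <ᵇ suc r) * listsSum n l (r ∸ a) (g ∘ (suc a ∷_))))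
    ≡⟨ ∑-cong (upTo n) (λ a → trans (∑-*ˡ (upTo (suc L)) (𝟙 (a <ᵇ suc r)) _) (cong (λ z → 𝟙 (a <ᵇ suc r) * z)
         (∑-listsSum n L (r ∸ a) (g ∘ (suc a ∷_)) (ℕₚ.≤-trans (ℕₚ.m∸n≤m r a) r≤n) (ℕₚ.≤-trans (ℕₚ.m∸n≤m r a) q)))) ⟩
  ∑ (upTo n) (λ a → 𝟙 (a <ᵇ suc r) * ∑ (comps L (r ∸ a)) (g ∘ (suc a ∷_))) ≡⟨ ∑-upTo-< n (suc r) p _ ⟩
  ∑ (upTo (suc r)) (λ a → ∑ (comps L (r ∸ a)) (g ∘ (suc a ∷_)))
    ≡⟨ ∑-cong (upTo (suc r)) (λ a → ∑-map (suc a ∷_) (comps L (r ∸ a)) g) ⟨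
  ∑ (upTo (suc r)) (λ a → ∑ (map (suc a ∷_) (comps L (r ∸ a))) g) ≡⟨ ∑-concatMap _ (upTo (suc r)) g ⟨
  ∑ (comps (suc L) (suc r)) g ∎
  where
  r≤n = ℕₚ.≤-trans (ℕₚ.n≤1+n r) p

∑-compositions : ∀ n g → ∑ (compositions n) g ≡ ∑ (comp n) g
∑-compositions n g = trans (∑-filter (isCompositionᵇ n) (concatMap (λ l → listsOfLen l n) (upTo (suc n))) g)
  (trans (∑-concatMap (λ l → listsOfLen l n) (upTo (suc n)) _) (∑-listsSum n n n g ℕₚ.≤-refl ℕₚ.≤-refl))

-- Proper colourings of the twinned cycle

T-ext : ∀ {a b} → (T a → T b) → (T b → T a) → a ≡ b
T-ext {true} {true} f g = refl
T-ext {true} {false} f g = ⊥-elim (f tt)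
T-ext {false} {true} f g = ⊥-elim (g tt)
T-ext {false} {false} f g = refl

allᵇ⇒All : ∀ (p : A → Bool) xs → T (allᵇ p xs) → All (T ∘ p) xs
allᵇ⇒All p [] t = []
allᵇ⇒All p (x ∷ xs) t = let px , pxs = to T-∧ t in px ∷ allᵇ⇒All p xs pxs

All⇒allᵇ : ∀ (p : A → Bool) {xs} → All (T ∘ p) xs → T (allᵇ p xs)
All⇒allᵇ p [] = tt
All⇒allᵇ p (px ∷ pxs) = from T-∧ (px , All⇒allᵇ p pxs)

≢⇒T : ∀ {a b : Fin N} → a ≢ b → T (not (a == b))
≢⇒T {a = a} {b} p with a Fin.≟ b
... | yes q = p q
... | no _ = tt

T⇒≢ : ∀ {a b : Fin N} → T (not (a == b)) → a ≢ b
T⇒≢ {a = a} {b} t with a Fin.≟ b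
... | no p = p

proper⇒ : ∀ {k} {adj : Fin k → Fin k → Bool} {κ : Fin k → Fin N} → T (proper adj κ) →
  ∀ u v → T (adj u v) → κ u ≢ κ v
proper⇒ {adj = adj} {κ} t u v e with adj u v | tabulate⁻ (allᵇ⇒All _ _ (tabulate⁻ (allᵇ⇒All _ _ t) u)) v
... | true | s = T⇒≢ s

⇒proper : ∀ {k} {adj : Fin k → Fin k → Bool} {κ : Fin k → Fin N} →
  (∀ u v → T (adj u v) → κ u ≢ κ v) → T (proper adj κ)
⇒proper {adj = adj} {κ} h = All⇒allᵇ _ (tabulate⁺ (λ u → All⇒allᵇ _ (tabulate⁺ (λ v → lem u v (adj u v) (h u v)))))
  where
  lem : ∀ u v b → (T b → κ u ≢ κ v) → T (not (b ∧ (κ u == κ v)))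
  lem u v true f = ≢⇒T (f tt)
  lem u v false f = tt

-- One of the two orientations of each edge of tw(C_n) for n = m + 2.
data Edge (m : ℕ) : ℕ → ℕ → Set where
  next  : ∀ {a} → Edge m a (suc a)
  close : Edge m 0 (suc m)
  new₀  : Edge m 0 (suc (suc m))
  new₁  : Edge m 1 (suc (suc m))

≡ᵇ-elim : ∀ {a b} → T (a ≡ᵇ b) → a ≡ b
≡ᵇ-elim {a} {b} = ℕₚ.≡ᵇ⇒≡ a b

≡ᵇ-refl : ∀ a → T (a ≡ᵇ a)
≡ᵇ-refl a = ℕₚ.≡⇒≡ᵇ a a refl

adj⇒Edge : ∀ m a b → T (cycAdjℕ (suc (suc m)) a b ∨ newAdjℕ (suc (suc m)) a b) → Edge m a b ⊎ Edge m b a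
adj⇒Edge m a b t with to T-∨ t
adj⇒Edge m a b t | inj₁ c with to (T-∨ {(b ≡ᵇ suc a) ∧ (b <ᵇ suc (suc m))}) c
... | inj₁ p with refl ← ≡ᵇ-elim {b} (proj₁ (to T-∧ p)) = inj₁ next
... | inj₂ c₂ with to (T-∨ {(a ≡ᵇ suc b) ∧ (a <ᵇ suc (suc m))}) c₂
... | inj₁ p with refl ← ≡ᵇ-elim {a} (proj₁ (to T-∧ p)) = inj₂ next
... | inj₂ c₃ with to (T-∨ {(a ≡ᵇ 0) ∧ (b ≡ᵇ suc m)}) c₃
... | inj₁ p with refl ← ≡ᵇ-elim {a} (proj₁ (to (T-∧ {a ≡ᵇ 0}) p)) | refl ← ≡ᵇ-elim {b} (proj₂ (to (T-∧ {a ≡ᵇ 0}) p)) = inj₁ close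
... | inj₂ p with refl ← ≡ᵇ-elim {b} (proj₁ (to (T-∧ {b ≡ᵇ 0}) p)) | refl ← ≡ᵇ-elim {a} (proj₂ (to (T-∧ {b ≡ᵇ 0}) p)) = inj₂ close
adj⇒Edge m a b t | inj₂ c = Sum.[ inj₂ ∘ half a b , inj₁ ∘ half b a ]′ (to T-∨ c)
  where
  half : ∀ a b → T ((a ≡ᵇ suc (suc m)) ∧ ((b ≡ᵇ 0) ∨ (b ≡ᵇ 1) ∨ (b ≡ᵇ suc m))) → Edge m b a
  half a b p with refl ← ≡ᵇ-elim {a} (proj₁ (to (T-∧ {a ≡ᵇ suc (suc m)}) p)) | to (T-∨ {b ≡ᵇ 0}) (proj₂ (to (T-∧ {a ≡ᵇ suc (suc m)}) p))
  ... | inj₁ q with refl ← ≡ᵇ-elim {b} q = new₀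
  ... | inj₂ r with to (T-∨ {b ≡ᵇ 1}) r
  ... | inj₁ q with refl ← ≡ᵇ-elim {b} q = new₁
  -- The edge from n - 1 to v' = n joins consecutive numbers, so it counts as `next`.
  ... | inj₂ q with refl ← ≡ᵇ-elim {b} q = next

Edge⇒adj : ∀ m a b → Edge m a b → b ≤ suc (suc m) → T (cycAdjℕ (suc (suc m)) a b ∨ newAdjℕ (suc (suc m)) a b)
Edge⇒adj m a .(suc a) next (s≤s p) with ℕₚ.m≤n⇒m<n∨m≡n p
... | inj₁ q = from T-∨ (inj₁ (from T-∨ (inj₁ (from T-∧ (≡ᵇ-refl a , ℕₚ.<⇒<ᵇ q)))))
... | inj₂ refl = from (T-∨ {cycAdjℕ (suc (suc m)) a (suc a)}) (inj₂ (from (T-∨ {(a ≡ᵇ suc (suc m)) ∧ _})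
  (inj₂ (from T-∧ (≡ᵇ-refl m , from (T-∨ {a ≡ᵇ 0}) (inj₂ (from (T-∨ {a ≡ᵇ 1}) (inj₂ (≡ᵇ-refl m)))))))))
Edge⇒adj m .0 .(suc m) close p = from (T-∨ {cycAdjℕ (suc (suc m)) 0 (suc m)}) (inj₁
  (from (T-∨ {(suc m ≡ᵇ 1) ∧ _}) (inj₂ (from (T-∨ {m ≡ᵇ m}) (inj₁ (≡ᵇ-refl m))))))
Edge⇒adj m .0 .(suc (suc m)) new₀ p = from (T-∨ {cycAdjℕ (suc (suc m)) 0 (suc (suc m))}) (inj₂ (from T-∧ (≡ᵇ-refl m , tt)))
Edge⇒adj m .1 .(suc (suc m)) new₁ p = from (T-∨ {cycAdjℕ (suc (suc m)) 1 (suc (suc m))}) (inj₂ (from T-∧ (≡ᵇ-refl m , tt)))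

-- Here c and a are the colours of v = 0 and of vertex 1, and g lists the colours of the vertices from 1 on.
good : Fin N → Fin N → ∀ {k} → (Fin (suc (suc k)) → Fin N) → Bool
good c a {zero} g = not (g zero == g (suc zero)) ∧ not (a == g (suc zero)) ∧ not (c == g (suc zero)) ∧ not (c == g zero)
good c a {suc k} g = not (g zero == g (suc zero)) ∧ good c a (g ∘ suc)

-- Position k + 1 of `g` is v' and position k is the vertex n - 1. The edge between them is part of
-- `chain`, which leaves v' its edges to 0 and 1, and n - 1 its edge to 0.
record Good (c a : Fin N) {k} (g : Fin (suc (suc k)) → Fin N) : Set where
  field
    chain   : ∀ u v → toℕ v ≡ suc (toℕ u) → g u ≢ g v
    last≢   : ∀ u → toℕ u ≡ suc k → a ≢ g u × c ≢ g u
    before≢ : ∀ u → toℕ u ≡ k → c ≢ g u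
open Good

good⇒ : ∀ (c a : Fin N) {k} (g : Fin (suc (suc k)) → Fin N) → T (good c a g) → Good c a g
good⇒ c a {zero} g t = let p , r = to (T-∧ {not (g zero == g (suc zero))}) t
                           q , s = to (T-∧ {not (a == g (suc zero))}) r
                           x , y = to (T-∧ {not (c == g (suc zero))}) s in record
  { chain = λ { zero (suc zero) refl → T⇒≢ p }
  ; last≢ = λ { (suc zero) refl → T⇒≢ q , T⇒≢ x }
  ; before≢ = λ { zero refl → T⇒≢ y }
  }
good⇒ c a {suc k} g t = let p , r = to (T-∧ {not (g zero == g (suc zero))}) t
                            G = good⇒ c a (g ∘ suc) r in record
  { chain = λ { zero (suc zero) refl → T⇒≢ p
              ; (suc u) (suc v) e → chain G u v (ℕₚ.suc-injective e) }
  ; last≢ = λ { (suc u) e → last≢ G u (ℕₚ.suc-injective e) }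
  ; before≢ = λ { (suc u) e → before≢ G u (ℕₚ.suc-injective e) }
  }

⇒good : ∀ (c a : Fin N) {k} (g : Fin (suc (suc k)) → Fin N) → Good c a g → T (good c a g)
⇒good c a {zero} g G = from T-∧ (≢⇒T (chain G zero (suc zero) refl) ,
  from T-∧ (≢⇒T (proj₁ (last≢ G (suc zero) refl)) ,
  from T-∧ (≢⇒T (proj₂ (last≢ G (suc zero) refl)) , ≢⇒T (before≢ G zero refl))))
⇒good c a {suc k} g G = from T-∧ (≢⇒T (chain G zero (suc zero) refl) , ⇒good c a (g ∘ suc) record
  { chain = λ u v e → chain G (suc u) (suc v) (cong suc e)
  ; last≢ = λ u e → last≢ G (suc u) (cong suc e)
  ; before≢ = λ u e → before≢ G (suc u) (cong suc e)
  })

proper-good : ∀ m (κ : Fin (suc (suc (suc m))) → Fin N) →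
  proper (twAdj (suc (suc m))) κ ≡ not (κ zero == κ (suc zero)) ∧ good (κ zero) (κ (suc zero)) (κ ∘ suc)
proper-good m κ = T-ext forth back
  where
  forth : T (proper (twAdj (suc (suc m))) κ) → T (not (κ zero == κ (suc zero)) ∧ good (κ zero) (κ (suc zero)) (κ ∘ suc))
  forth t = from T-∧ (≢⇒T (edge zero (suc zero) next) , ⇒good _ _ _ record
    { chain = λ u v e → edge (suc u) (suc v) (subst (Edge m (suc (toℕ u)) ∘ suc) (sym e) next)
    ; last≢ = λ u e → edge (suc zero) (suc u) (subst (Edge m 1 ∘ suc) (sym e) new₁) ,
                       edge zero (suc u) (subst (Edge m 0 ∘ suc) (sym e) new₀)
    ; before≢ = λ u e → edge zero (suc u) (subst (Edge m 0 ∘ suc) (sym e) close)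
    })
    where
    edge : ∀ u v → Edge m (toℕ u) (toℕ v) → κ u ≢ κ v
    edge u v e = proper⇒ {adj = twAdj (suc (suc m))} t u v (Edge⇒adj m (toℕ u) (toℕ v) e (Finₚ.toℕ≤pred[n] v))
  back : T (not (κ zero == κ (suc zero)) ∧ good (κ zero) (κ (suc zero)) (κ ∘ suc)) → T (proper (twAdj (suc (suc m))) κ)
  back t = ⇒proper (λ u v e → Sum.[ edge u v refl refl , (λ f p → edge v u refl refl f (sym p)) ]′ (adj⇒Edge m (toℕ u) (toℕ v) e))
    where
    G = good⇒ _ _ _ (proj₂ (to (T-∧ {not (κ zero == κ (suc zero))}) t))
    edge : ∀ u v {a b} → toℕ u ≡ a → toℕ v ≡ b → Edge m a b → κ u ≢ κ v
    edge zero (suc zero) p q next = T⇒≢ (proj₁ (to (T-∧ {not (κ zero == κ (suc zero))}) t))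
    edge zero (suc (suc v)) p q next with refl ← p with () ← q
    edge (suc u) (suc v) p q next = chain G u v (trans (ℕₚ.suc-injective q) (sym p))
    edge zero (suc v) p q close = before≢ G v (ℕₚ.suc-injective q)
    edge zero (suc v) p q new₀ = proj₂ (last≢ G v (ℕₚ.suc-injective q))
    edge (suc zero) (suc v) p q new₁ = proj₁ (last≢ G v (ℕₚ.suc-injective q))

-- Summation over the colours of the vertices

∑-scale : ∀ (xs : List A) (c : A → ℤ) k (f : A → ℤ) → ∑ xs (λ x → c x * (k * f x)) ≡ k * ∑ xs (λ x → c x * f x)
∑-scale xs c k f = trans (∑-cong xs (λ x → *-left-comm (c x) k (f x))) (∑-*ˡ xs k _)

-- Completions of a partial colouring in which v has colour c, vertex 1 colour a, and the path has reached colour p.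
completions : Series N → ℕ → Fin N → Fin N → Fin N → Series N
completions {N} φ m c a p v = ∑ (allFin N) (λ d → neq c d * (neq d a *
  ∑ (allFin N) (λ b → neq c b * (neq d b * walks φ m p b (bump d v)))))

completions-suc : ∀ (φ : Series N) m c a p v →
  ∑ (allFin N) (λ x → neq p x * completions φ m c a x (bump p v)) ≡ completions φ (suc m) c a p v
completions-suc {N} φ m c a p v = begin
  ∑ (allFin N) (λ x → neq p x * completions φ m c a x (bump p v))
    ≡⟨ ∑-swap-* (allFin N) (allFin N) (neq p) (neq c) _ ⟩
  ∑ (allFin N) (λ d → neq c d * ∑ (allFin N) (λ x → neq p x * (neq d a *
    ∑ (allFin N) (λ b → neq c b * (neq d b * walks φ m x b (bump d (bump p v)))))))
    ≡⟨ ∑-cong (allFin N) (λ d → cong (λ z → neq c d * z) (begin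
         ∑ (allFin N) (λ x → neq p x * (neq d a * ∑ (allFin N) (λ b → neq c b * (neq d b * walks φ m x b (bump d (bump p v))))))
           ≡⟨ ∑-scale (allFin N) (neq p) (neq d a) _ ⟩
         neq d a * ∑ (allFin N) (λ x → neq p x * ∑ (allFin N) (λ b → neq c b * (neq d b * walks φ m x b (bump d (bump p v)))))
           ≡⟨ cong (λ z → neq d a * z) (∑-swap-* (allFin N) (allFin N) (neq p) (neq c) _) ⟩
         neq d a * ∑ (allFin N) (λ b → neq c b * ∑ (allFin N) (λ x → neq p x * (neq d b * walks φ m x b (bump d (bump p v)))))
           ≡⟨ cong (λ z → neq d a * z) (∑-cong (allFin N) (λ b → cong (λ z → neq c b * z)
                (trans (∑-scale (allFin N) (neq p) (neq d b) _)
                  (cong (λ v′ → neq d b * ∑ (allFin N) (λ x → neq p x * walks φ m x b v′)) (bump-comm d p v))))) ⟩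
         neq d a * ∑ (allFin N) (λ b → neq c b * (neq d b * walks φ (suc m) p b (bump d v))) ∎)) ⟩
  completions φ (suc m) c a p v ∎

-- The enumeration chooses the colour d of v' last, while `completions` sums over it first. Each
-- induction step appends a path vertex and commutes its sum past those over d and b.
∑-good : ∀ (φ : Series N) m c a p v →
  ∑ (allFuns (allFin N) (suc m)) (λ f → 𝟙 (good c a (p ∷ᶠ f)) * φ (addColours (bump p v) f)) ≡ completions φ m c a p v
∑-good {N} φ zero c a p v = trans (∑-allFuns (allFin N) 0 _) (∑-cong (allFin N) (λ d → begin
  ∑ (allFuns (allFin N) 0) (λ f → 𝟙 (good c a (p ∷ᶠ (d ∷ᶠ f))) * φ (bump d (bump p v)))
    ≡⟨ ∑-singleton _ _ ⟩
  𝟙 (not (p == d) ∧ not (a == d) ∧ not (c == d) ∧ not (c == p)) * φ (bump d (bump p v))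
    ≡⟨ cong₂ _*_ (trans (𝟙-∧ (not (p == d)) _) (cong₂ _*_ (trans (𝟙-not (p == d)) (neq-sym p d))
         (trans (𝟙-∧ (not (a == d)) _) (cong₂ _*_ (trans (𝟙-not (a == d)) (neq-sym a d))
         (trans (𝟙-∧ (not (c == d)) _) (cong₂ _*_ (𝟙-not (c == d)) (𝟙-not (c == p))))))))
         (cong φ (bump-comm d p v)) ⟩
  neq d p * (neq d a * (neq c d * neq c p)) * φ (bump p (bump d v))
    ≡⟨ lem (neq d p) (neq d a) (neq c d) (neq c p) (φ (bump p (bump d v))) ⟩
  neq c d * (neq d a * (neq c p * (neq d p * φ (bump p (bump d v)))))
    -- The path is down to one vertex, so its end colour b equals p.
    ≡⟨ cong (λ z → neq c d * (neq d a * z)) (sym (trans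
         (∑-cong (allFin N) (λ b → lem₂ (neq c b) (neq d b) (eq p b) (φ (bump p (bump d v)))))
         (∑-eq p (λ b → neq c b * (neq d b * φ (bump p (bump d v))))))) ⟩
  neq c d * (neq d a * ∑ (allFin N) (λ b → neq c b * (neq d b * walks φ 0 p b (bump d v)))) ∎))
  where
  lem : ∀ x y z t f → x * (y * (z * t)) * f ≡ z * (y * (t * (x * f)))
  lem = solve-∀
  lem₂ : ∀ x y z f → x * (y * (z * f)) ≡ z * (x * (y * f))
  lem₂ = solve-∀
∑-good {N} φ (suc m) c a p v = trans (∑-allFuns (allFin N) (suc m) _) (trans (∑-cong (allFin N) (λ x → begin
  ∑ (allFuns (allFin N) (suc m)) (λ f → 𝟙 (not (p == x) ∧ good c a (x ∷ᶠ f)) * φ (addColours (bump x (bump p v)) f))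
    ≡⟨ ∑-cong (allFuns (allFin N) (suc m)) (λ f → trans
         (cong (_* φ (addColours (bump x (bump p v)) f)) (trans (𝟙-∧ (not (p == x)) _) (cong (_* 𝟙 (good c a (x ∷ᶠ f))) (𝟙-not (p == x)))))
         (ℤₚ.*-assoc (neq p x) (𝟙 (good c a (x ∷ᶠ f))) _)) ⟩
  ∑ (allFuns (allFin N) (suc m)) (λ f → neq p x * (𝟙 (good c a (x ∷ᶠ f)) * φ (addColours (bump x (bump p v)) f)))
    ≡⟨ ∑-*ˡ (allFuns (allFin N) (suc m)) (neq p x) _ ⟩
  neq p x * ∑ (allFuns (allFin N) (suc m)) (λ f → 𝟙 (good c a (x ∷ᶠ f)) * φ (addColours (bump x (bump p v)) f))
    ≡⟨ cong (λ z → neq p x * z) (∑-good φ m c a x (bump p v)) ⟩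
  neq p x * completions φ m c a x (bump p v) ∎)) (completions-suc φ m c a p v))

∑-proper : ∀ (φ : Series N) m v →
  ∑ (allFuns (allFin N) (3 ℕ.+ m)) (λ κ → 𝟙 (proper (twAdj (2 ℕ.+ m)) κ) * φ (addColours v κ)) ≡ twin φ m v
∑-proper {N} φ m v = begin
  ∑ (allFuns (allFin N) (3 ℕ.+ m)) (λ κ → 𝟙 (proper (twAdj (2 ℕ.+ m)) κ) * φ (addColours v κ))
    ≡⟨ ∑-cong (allFuns (allFin N) (3 ℕ.+ m)) (λ κ → trans
         (cong (_* φ (addColours v κ)) (trans (cong 𝟙 (proper-good m κ)) (trans (𝟙-∧ (not (κ zero == κ (suc zero))) _)
           (cong (_* 𝟙 (good (κ zero) (κ (suc zero)) (κ ∘ suc))) (𝟙-not (κ zero == κ (suc zero)))))))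
         (ℤₚ.*-assoc (neq (κ zero) (κ (suc zero))) _ _)) ⟩
  ∑ (allFuns (allFin N) (3 ℕ.+ m)) (λ κ → neq (κ zero) (κ (suc zero)) *
    (𝟙 (good (κ zero) (κ (suc zero)) (κ ∘ suc)) * φ (addColours v κ)))
    ≡⟨ trans (∑-allFuns (allFin N) (2 ℕ.+ m) _) (∑-cong (allFin N) (λ c → ∑-allFuns (allFin N) (1 ℕ.+ m) _)) ⟩
  ∑ (allFin N) (λ c → ∑ (allFin N) (λ a → ∑ (allFuns (allFin N) (1 ℕ.+ m)) (λ f →
    neq c a * (𝟙 (good c a (a ∷ᶠ f)) * φ (addColours (bump a (bump c v)) f)))))
    ≡⟨ ∑-cong (allFin N) (λ c → ∑-cong (allFin N) (λ a → trans (∑-*ˡ (allFuns (allFin N) (1 ℕ.+ m)) (neq c a) _)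
         (cong (λ z → neq c a * z) (∑-good φ m c a a (bump c v))))) ⟩
  ∑ (allFin N) (λ c → ∑ (allFin N) (λ a → neq c a * completions φ m c a a (bump c v)))
    ≡⟨ ∑-cong (allFin N) (λ c → ∑-swap-* (allFin N) (allFin N) (neq c) (neq c) _) ⟩
  twin φ m v ∎

-- From integers to rationals

fromℚᵘ-homo-+ : ∀ p q → fromℚᵘ (p ℚᵘ.+ q) ≡ fromℚᵘ p +ℚ fromℚᵘ q
fromℚᵘ-homo-+ p q = ℚₚ.toℚᵘ-injective (ℚᵘₚ.≃-trans (ℚₚ.toℚᵘ-fromℚᵘ (p ℚᵘ.+ q))
  (ℚᵘₚ.≃-sym (ℚᵘₚ.≃-trans (ℚₚ.toℚᵘ-homo-+ (fromℚᵘ p) (fromℚᵘ q))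
    (ℚᵘₚ.+-cong (ℚₚ.toℚᵘ-fromℚᵘ p) (ℚₚ.toℚᵘ-fromℚᵘ q)))))

fromℚᵘ-homo-* : ∀ p q → fromℚᵘ (p ℚᵘ.* q) ≡ fromℚᵘ p *ℚ fromℚᵘ q
fromℚᵘ-homo-* p q = ℚₚ.toℚᵘ-injective (ℚᵘₚ.≃-trans (ℚₚ.toℚᵘ-fromℚᵘ (p ℚᵘ.* q))
  (ℚᵘₚ.≃-sym (ℚᵘₚ.≃-trans (ℚₚ.toℚᵘ-homo-* (fromℚᵘ p) (fromℚᵘ q))
    (ℚᵘₚ.*-cong (ℚₚ.toℚᵘ-fromℚᵘ p) (ℚₚ.toℚᵘ-fromℚᵘ q)))))

-- Chosen so that `ℕtoℚ n` is `ι (+ n)` by computation.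
ι : ℤ → ℚ
ι z = fromℚᵘ (mkℚᵘ z 0)

ι-+ : ∀ a b → ι (a + b) ≡ ι a +ℚ ι b
ι-+ a b = trans (ℚₚ.fromℚᵘ-cong {mkℚᵘ (a + b) 0} {mkℚᵘ a 0 ℚᵘ.+ mkℚᵘ b 0} (*≡* (lem a b)))
  (fromℚᵘ-homo-+ (mkℚᵘ a 0) (mkℚᵘ b 0))
  where
  lem : ∀ a b → (a + b) * 1ℤ ≡ (a * 1ℤ + b * 1ℤ) * 1ℤ
  lem = solve-∀

ι-* : ∀ a b → ι (a * b) ≡ ι a *ℚ ι b
ι-* a b = fromℚᵘ-homo-* (mkℚᵘ a 0) (mkℚᵘ b 0)

ι-− : ∀ a b → ι (a - b) ≡ ι a -ℚ ι b
ι-− a b = begin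
  ι (a - b) ≡⟨ ℚₚ.+-identityʳ _ ⟨
  ι (a - b) +ℚ ι 0ℤ ≡⟨ cong (ι (a - b) +ℚ_) (ℚₚ.+-inverseʳ (ι b)) ⟨
  ι (a - b) +ℚ (ι b -ℚ ι b) ≡⟨ ℚₚ.+-assoc (ι (a - b)) (ι b) (-ℚ ι b) ⟨
  ι (a - b) +ℚ ι b -ℚ ι b ≡⟨ cong (_-ℚ ι b) (ι-+ (a - b) b) ⟨
  ι (a - b + b) -ℚ ι b ≡⟨ cong (λ z → ι z -ℚ ι b) (lem a b) ⟩
  ι a -ℚ ι b ∎
  where
  lem : ∀ a b → a - b + b ≡ a
  lem = solve-∀

-- Here 1/i_1 disappears: w_I has i_1 as its leading factor.
ι-recip : ∀ k p → recip (suc k) *ℚ ι (+ (suc k ℕ.* p)) ≡ ι (+ p)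
ι-recip k p = trans (sym (fromℚᵘ-homo-* (mkℚᵘ (+ 1) k) (mkℚᵘ (+ (suc k ℕ.* p)) 0)))
  (ℚₚ.fromℚᵘ-cong {mkℚᵘ (+ 1) k ℚᵘ.* mkℚᵘ (+ (suc k ℕ.* p)) 0} {mkℚᵘ (+ p) 0} (*≡* (begin
    + 1 * + (suc k ℕ.* p) * + 1 ≡⟨ cong (λ z → + 1 * z * + 1) (ℤₚ.pos-* (suc k) p) ⟩
    + 1 * (+ suc k * + p) * + 1 ≡⟨ lem (+ suc k) (+ p) ⟩
    + p * (+ suc k * + 1) ≡⟨ cong (+ p *_) (sym (ℤₚ.pos-* (suc k) 1)) ⟩
    + p * + suc (k ℕ.* 1) ∎)))
  where
  lem : ∀ x y → + 1 * (x * y) * + 1 ≡ y * (x * + 1)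
  lem = solve-∀

-- The equation is asked only where `p` holds; in the third sum this excludes a first part 0, for
-- which 1/i_1 has no meaning.
sumℚ-ι : ∀ (p : A → Bool) (f : A → ℚ) (z : A → ℤ) → (∀ x → p x ≡ true → f x ≡ ι (z x)) → ∀ xs →
  sumℚ (map f (filterᵇ p xs)) ≡ ι (∑ xs (λ x → 𝟙 (p x) * z x))
sumℚ-ι p f z h [] = cong ι (sym (∑-[] _))
sumℚ-ι p f z h (x ∷ xs) with p x in px
... | true = begin
  f x +ℚ sumℚ (map f (filterᵇ p xs)) ≡⟨ cong₂ _+ℚ_ (h x px) (sumℚ-ι p f z h xs) ⟩
  ι (z x) +ℚ ι (∑ xs (λ x → 𝟙 (p x) * z x)) ≡⟨ ι-+ (z x) _ ⟨
  ι (z x + ∑ xs (λ x → 𝟙 (p x) * z x))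
    ≡⟨ cong (λ y → ι (y + ∑ xs (λ x → 𝟙 (p x) * z x))) (trans (sym (ℤₚ.*-identityˡ (z x))) (cong (λ b → 𝟙 b * z x) (sym px))) ⟩
  ι (𝟙 (p x) * z x + ∑ xs (λ x → 𝟙 (p x) * z x)) ≡⟨ cong ι (∑-∷ x xs _) ⟨
  ι (∑ (x ∷ xs) (λ x → 𝟙 (p x) * z x)) ∎
... | false = begin
  sumℚ (map f (filterᵇ p xs)) ≡⟨ sumℚ-ι p f z h xs ⟩
  ι (∑ xs (λ x → 𝟙 (p x) * z x)) ≡⟨ cong ι (ℤₚ.+-identityˡ (∑ xs (λ x → 𝟙 (p x) * z x))) ⟨
  ι (0ℤ + ∑ xs (λ x → 𝟙 (p x) * z x))
    ≡⟨ cong (λ b → ι (𝟙 b * z x + ∑ xs (λ x → 𝟙 (p x) * z x))) (sym px) ⟩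
  ι (𝟙 (p x) * z x + ∑ xs (λ x → 𝟙 (p x) * z x)) ≡⟨ cong ι (∑-∷ x xs _) ⟨
  ι (∑ (x ∷ xs) (λ x → 𝟙 (p x) * z x)) ∎

term₁ : ∀ a b c → ℕtoℚ 2 *ℚ (ℕtoℚ a -ℚ ℕtoℚ 3) *ℚ ℕtoℚ b *ℚ ℕtoℚ c ≡ ι (+ 2 * (+ a - + 3) * + b * + c)
term₁ a b c = sym (trans (ι-* (+ 2 * (+ a - + 3) * + b) (+ c)) (cong (_*ℚ ι (+ c))
  (trans (ι-* (+ 2 * (+ a - + 3)) (+ b)) (cong (_*ℚ ι (+ b))
    (trans (ι-* (+ 2) (+ a - + 3)) (cong (ι (+ 2) *ℚ_) (ι-− (+ a) (+ 3))))))))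

term₂ : ∀ a b c → ℕtoℚ 2 *ℚ (ℕtoℚ 2 *ℚ ℕtoℚ a -ℚ ℕtoℚ 5) *ℚ ℕtoℚ b *ℚ ℕtoℚ c ≡
  ι (+ 2 * (+ 2 * + a - + 5) * + b * + c)
term₂ a b c = sym (trans (ι-* (+ 2 * (+ 2 * + a - + 5) * + b) (+ c)) (cong (_*ℚ ι (+ c))
  (trans (ι-* (+ 2 * (+ 2 * + a - + 5)) (+ b)) (cong (_*ℚ ι (+ b))
    (trans (ι-* (+ 2) (+ 2 * + a - + 5)) (cong (ι (+ 2) *ℚ_)
      (trans (ι-− (+ 2 * + a) (+ 5)) (cong (_-ℚ ι (+ 5)) (ι-* (+ 2) (+ a))))))))))

term₃ : ∀ k I c → ℕtoℚ 4 *ℚ ((ℕtoℚ (suc k) -ℚ ℕtoℚ 3) +ℚ recip (suc k)) *ℚ ℕtoℚ (w (suc k ∷ I)) *ℚ ℕtoℚ c ≡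
  ι (+ 4 * ((+ suc k - + 3) * + w (suc k ∷ I) + + tailWeight (suc k ∷ I)) * + c)
term₃ k I c = sym (begin
  ι (+ 4 * (x * W + p) * + c) ≡⟨ ι-* (+ 4 * (x * W + p)) (+ c) ⟩
  ι (+ 4 * (x * W + p)) *ℚ ι (+ c) ≡⟨ cong (_*ℚ ι (+ c)) (begin
    ι (+ 4 * (x * W + p)) ≡⟨ ι-* (+ 4) (x * W + p) ⟩
    ι (+ 4) *ℚ ι (x * W + p) ≡⟨ cong (ι (+ 4) *ℚ_) (begin
      ι (x * W + p) ≡⟨ ι-+ (x * W) p ⟩
      ι (x * W) +ℚ ι p ≡⟨ cong₂ _+ℚ_ (trans (ι-* x W) (cong (_*ℚ ι W) (ι-− (+ suc k) (+ 3)))) (sym (ι-recip k (product (map (_∸ 1) I)))) ⟩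
      (ℕtoℚ (suc k) -ℚ ℕtoℚ 3) *ℚ ι W +ℚ recip (suc k) *ℚ ι W
        ≡⟨ ℚₚ.*-distribʳ-+ (ι W) (ℕtoℚ (suc k) -ℚ ℕtoℚ 3) (recip (suc k)) ⟨
      ((ℕtoℚ (suc k) -ℚ ℕtoℚ 3) +ℚ recip (suc k)) *ℚ ι W ∎) ⟩
    ι (+ 4) *ℚ (((ℕtoℚ (suc k) -ℚ ℕtoℚ 3) +ℚ recip (suc k)) *ℚ ι W)
      ≡⟨ ℚₚ.*-assoc (ι (+ 4)) ((ℕtoℚ (suc k) -ℚ ℕtoℚ 3) +ℚ recip (suc k)) (ι W) ⟨
    ι (+ 4) *ℚ ((ℕtoℚ (suc k) -ℚ ℕtoℚ 3) +ℚ recip (suc k)) *ℚ ι W ∎) ⟩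
  _ ∎)
  where
  x = + suc k - + 3
  W = + w (suc k ∷ I)
  p = + tailWeight (suc k ∷ I)

∑-term : ∀ n (b : List ℕ → Bool) (s : List ℕ → ℤ) (J : List ℕ → List ℕ) (α : Fin N → ℕ) →
  ∑ (compositions n) (λ I → 𝟙 (b I) * (s I * + eCoeff N (J I) α)) ≡
  ∑ (comp n) (λ I → 𝟙 (b I) * s I * E (indicator α) (J I) 𝟎)
∑-term {N} n b s J α = trans (∑-compositions n _) (∑-cong (comp n) (λ I →
  trans (sym (ℤₚ.*-assoc (𝟙 (b I)) (s I) (+ eCoeff N (J I) α)))
    (cong (λ z → 𝟙 (b I) * s I * z) (eCoeff-E N (J I) α))))

rhsCoeff-ι : ∀ m N (α : Fin N → ℕ) → rhsCoeff (2 ℕ.+ m) N α ≡ ι (twin (indicator α) m 𝟎)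
rhsCoeff-ι m N α = begin
  rhsCoeff (2 ℕ.+ m) N α
    ≡⟨ cong₂ _+ℚ_ (cong₂ _+ℚ_
         (sumℚ-ι _ _ _ (λ I _ → term₁ (first I) (w (1 ∷ I)) (eCoeff N (1 ∷ I) α)) (compositions (2 ℕ.+ m)))
         (sumℚ-ι _ _ _ (λ I _ → term₂ (first I) (w I) (eCoeff N I α)) (compositions (3 ℕ.+ m))))
         (sumℚ-ι _ _ (λ I → + 4 * ((+ first I - + 3) * + w I + + tailWeight I) * + eCoeff N (I ++ [ 2 ]) α)
           third (compositions (1 ℕ.+ m))) ⟩
  ι X₁ +ℚ ι X₂ +ℚ ι X₃ ≡⟨ cong (_+ℚ ι X₃) (ι-+ X₁ X₂) ⟨
  ι (X₁ + X₂) +ℚ ι X₃ ≡⟨ ι-+ (X₁ + X₂) X₃ ⟨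
  ι (X₁ + X₂ + X₃)
    ≡⟨ cong ι (trans (cong₂ _+_ (cong₂ _+_ (∑-term (2 ℕ.+ m) b₁ s₁ (1 ∷_) α) (∑-term (3 ℕ.+ m) b₂ s₂ id α))
         (∑-term (1 ℕ.+ m) b₃ s₃ (_++ [ 2 ]) α))
         (trans (rhs-series (indicator α) m 𝟎) (sym (twin-series (indicator α) m 𝟎)))) ⟩
  ι (twin (indicator α) m 𝟎) ∎
  where
  b₁ b₂ b₃ : List ℕ → Bool
  b₁ = firstGe 4
  b₂ I = allPartsGe2 I ∧ firstGe 3 I ∧ lastGe 3 I
  b₃ I = allPartsGe2 I ∧ firstGe 3 I
  s₁ s₂ s₃ : List ℕ → ℤ
  s₁ I = + 2 * (+ first I - + 3) * + w (1 ∷ I)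
  s₂ I = + 2 * (+ 2 * + first I - + 5) * + w I
  s₃ I = + 4 * ((+ first I - + 3) * + w I + + tailWeight I)
  X₁ = ∑ (compositions (2 ℕ.+ m)) (λ I → 𝟙 (b₁ I) * (s₁ I * + eCoeff N (1 ∷ I) α))
  X₂ = ∑ (compositions (3 ℕ.+ m)) (λ I → 𝟙 (b₂ I) * (s₂ I * + eCoeff N I α))
  X₃ = ∑ (compositions (1 ℕ.+ m)) (λ I → 𝟙 (b₃ I) * (s₃ I * + eCoeff N (I ++ [ 2 ]) α))
  third : ∀ I → b₃ I ≡ true →
    ℕtoℚ 4 *ℚ ((ℕtoℚ (first I) -ℚ ℕtoℚ 3) +ℚ recip (first I)) *ℚ ℕtoℚ (w I) *ℚ ℕtoℚ (eCoeff N (I ++ [ 2 ]) α) ≡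
    ι (s₃ I * + eCoeff N (I ++ [ 2 ]) α)
  third [] ()
  third (zero ∷ I) ()
  third (suc k ∷ I) _ = term₃ k I (eCoeff N (suc k ∷ I ++ [ 2 ]) α)

theorem4p2 : (n : ℕ) → 3 ≤ n → (N : ℕ) → (α : Fin N → ℕ) →
    ℕtoℚ (XCoeff (suc n) (twAdj n) N α) ≡ rhsCoeff n N α
theorem4p2 (suc (suc m)) _ N α = begin
  ι (+ XCoeff (3 ℕ.+ m) (twAdj (2 ℕ.+ m)) N α)
    ≡⟨ cong ι (trans (XCoeff-∑ (3 ℕ.+ m) (twAdj (2 ℕ.+ m)) N α) (∑-proper (indicator α) m 𝟎)) ⟩
  ι (twin (indicator α) m 𝟎) ≡⟨ rhsCoeff-ι m N α ⟨
  rhsCoeff (2 ℕ.+ m) N α ∎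
theorem4p2 (suc zero) (s≤s ()) N α
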